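{- Let $A\in\mathbb R^{n\times d}$ and let $k\ge 1$. Let $s=O(k\log\log k)$. Let $g:\mathbb R\to\mathbb R_{\ge 0}$ be a loss function satisfying the $\mathsf{ati}_{g,t}$-approximate triangle inequality for $t=2s+1$ and having at least $\mathsf{lin}_g$-linear growth. Furthermore, suppose that for each $m$ there is an algorithm which, given any $B\in\mathbb R^{n\times m}$ and $b\in\mathbb R^n$, outputs $\tilde x\in\mathbb R^m$ such that $$\|B\tilde x-b\|_g\le \mathsf{reg}_{g,m}\cdot\min_{x\in\mathbb R^m}\|Bx-b\|_g .$$ Then there is an algorithm which outputs a subset $S\subseteq[d]$ of $|S|=O(k(\log\log k)(\log d)^2)$ columns and a matrix $X\in\mathbb R^{S\times d}$ such that $$\|A-A|^S X\|_g\le O(\sqrt s)\,\frac{\mathsf{reg}_{g,O(s\log d)}\cdot\mathsf{ati}_{g,2s+1}}{\mathsf{lin}_g}\ \min_{\operatorname{rank}(\hat A)\le k}\|A-\hat A\|_g .$$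
   Context: For $g:\mathbb R\to\mathbb R_{\ge0}$ and a matrix $M$ (or a vector), $\|M\|_g:=\sum_{i,j}g(M_{i,j})$ (an abuse of notation; it need not be a norm). $g$ satisfies the $\mathsf{ati}_{g,t}$-approximate triangle inequality if $g(\sum_{i=1}^t x_i)\le \mathsf{ati}_{g,t}\sum_{i=1}^t g(x_i)$ for all $x_1,\dots,x_t\in\mathbb R$. $g$ has at least $\mathsf{lin}_g$-linear growth (with $\mathsf{lin}_g>0$) if for all $0<|x|\le|y|$, $g(y)/g(x)\ge \mathsf{lin}_g\cdot|y|/|x|$. For $S\subseteq[d]$, $A|^S$ is the $n\times S$ matrix formed by the columns of $A$ indexed by $S$; $\mathbb R^{S\times d}$ denotes matrices with rows indexed by $S$. The minimum on the right is over $\hat A\in\mathbb R^{n\times d}$. $O(\cdot)$ hides absolute constants; $\mathsf{reg}_{g,O(s\log d)}$ means $\mathsf{reg}_{g,m}$ for a suitable $m=O(s\log d)$, with $\mathsf{reg}_{g,m}$ taken nondecreasing in $m$. (Iterated) logarithms in bounds are read as at least $1$. -}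

module Defs where

open import Level using (0ℓ)
open import Algebra.Bundles using (CommutativeRing)
import Algebra.Construct.NaturalChoice.Max as Max
import Algebra.Definitions.RawMonoid as RawMonoidDefs
import Algebra.Properties.Ring as RingProperties
open import Data.Fin.Base using (Fin; zero; suc)
open import Data.Fin.Subset using (Subset; _∈_)
open import Data.Fin.Subset.Properties using (_∈?_)
open import Data.Nat.Base as ℕ using (ℕ; zero; suc)
open import Data.Nat.Logarithm using (⌈log₂_⌉)
open import Data.Product.Base using (Σ; Σ-syntax; ∃; _×_; _,_; proj₁; proj₂)
open import Data.Sum.Base using (inj₁; inj₂)
open import Data.Vec.Functional using (Vector)
open import Relation.Binary.Bundles using (DecTotalOrder)
open import Relation.Binary.Core using (Rel)
import Relation.Binary.Construct.NonStrictToStrict as Strict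
open import Relation.Binary.Structures using (IsDecTotalOrder)
open import Relation.Nullary using (¬_; Dec; yes; no)

-- Logarithms inside O(·), truncated below at 1.  Up to absolute constant
-- factors neither the base nor the rounding matters.

log : ℕ → ℕ
log n = 1 ℕ.⊔ ⌈log₂ n ⌉

loglog : ℕ → ℕ
loglog n = log (log n)

-- The primitives of the real-RAM model: field operations and exact
-- comparisons.  The value of _⁻¹ at 0# is unspecified.

record OrderedField : Set₁ where
  infix 4 _≤_
  infix 8 _⁻¹
  field
    commutativeRing : CommutativeRing 0ℓ 0ℓ

  open CommutativeRing commutativeRing public hiding (zero)

  field
    _≤_             : Rel Carrier 0ℓ
    isDecTotalOrder : IsDecTotalOrder _≈_ _≤_
    +-monoʳ-≤       : ∀ x {y z} → y ≤ z → x + y ≤ x + z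
    *-nonNegative   : ∀ {x y} → 0# ≤ x → 0# ≤ y → 0# ≤ x * y
    0≉1             : ¬ (0# ≈ 1#)
    _⁻¹             : Carrier → Carrier
    ⁻¹-inverseʳ     : ∀ {x} → ¬ (x ≈ 0#) → x * x ⁻¹ ≈ 1#

  decTotalOrder : DecTotalOrder 0ℓ 0ℓ 0ℓ
  decTotalOrder = record { isDecTotalOrder = isDecTotalOrder }

  open IsDecTotalOrder isDecTotalOrder public
    using (_≤?_; total; ≤-respˡ-≈; ≤-respʳ-≈)
    renaming (trans to ≤-trans; reflexive to ≤-reflexive; refl to ≤-refl)

  open Strict _≈_ _≤_ public using (_<_)
  open Max (DecTotalOrder.totalOrder decTotalOrder) public using (_⊔_)
  open RawMonoidDefs +-rawMonoid public using (sum)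

  infixl 7 _/_
  _/_ : Carrier → Carrier → Carrier
  x / y = x * y ⁻¹

  ∣_∣ : Carrier → Carrier
  ∣ x ∣ = x ⊔ - x

  fromℕ : ℕ → Carrier
  fromℕ n = RawMonoidDefs._×_ +-rawMonoid n 1#

  open RingProperties ring using (-0#≈0#; -‿distribˡ-*; -‿distribʳ-*; -‿involutive)

  +-nonNegative : ∀ {x y} → 0# ≤ x → 0# ≤ y → 0# ≤ x + y
  +-nonNegative {x} 0≤x 0≤y =
    ≤-trans 0≤x (≤-respˡ-≈ (+-identityʳ x) (+-monoʳ-≤ x 0≤y))

  x≤y⇒0≤y-x : ∀ {x y} → x ≤ y → 0# ≤ y - x
  x≤y⇒0≤y-x {x} {y} x≤y =
    ≤-respˡ-≈ (-‿inverseˡ x) (≤-respʳ-≈ (+-comm (- x) y) (+-monoʳ-≤ (- x) x≤y))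

  0≤y-x⇒x≤y : ∀ {x y} → 0# ≤ y - x → x ≤ y
  0≤y-x⇒x≤y {x} {y} p = ≤-respˡ-≈ (+-identityʳ x) (≤-respʳ-≈ eq (+-monoʳ-≤ x p))
    where
    eq : x + (y - x) ≈ y
    eq = trans (+-comm x (y - x))
           (trans (+-assoc y (- x) x)
             (trans (+-congˡ (-‿inverseˡ x)) (+-identityʳ y)))

  0≤1 : 0# ≤ 1#
  0≤1 with total 0# 1#
  ... | inj₁ p = p
  ... | inj₂ 1≤0 = ≤-respʳ-≈ eq (*-nonNegative 0≤-1 0≤-1)
    where
    0≤-1 : 0# ≤ - 1#
    0≤-1 = ≤-respʳ-≈ (+-identityˡ (- 1#)) (x≤y⇒0≤y-x 1≤0)
    eq : - 1# * - 1# ≈ 1#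
    eq = trans (sym (-‿distribˡ-* 1# (- 1#)))
           (trans (-‿cong (*-identityˡ (- 1#))) (-‿involutive 1#))

  fromℕ-nonNegative : ∀ n → 0# ≤ fromℕ n
  fromℕ-nonNegative zero    = ≤-refl
  fromℕ-nonNegative (suc n) = +-nonNegative 0≤1 (fromℕ-nonNegative n)

  sum-nonNegative : ∀ {n} (v : Vector Carrier n) → (∀ i → 0# ≤ v i) → 0# ≤ sum v
  sum-nonNegative {zero}  v p = ≤-refl
  sum-nonNegative {suc n} v p =
    +-nonNegative (p zero) (sum-nonNegative (λ i → v (suc i)) (λ i → p (suc i)))

  x≤1+y : ∀ {x y} → 0# ≤ y → x * x ≤ y → x ≤ 1# + y
  x≤1+y {x} {y} 0≤y x²≤y with total x 1#
  ... | inj₁ x≤1 = ≤-trans x≤1 (≤-respˡ-≈ (+-identityʳ 1#) (+-monoʳ-≤ 1# 0≤y))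
  ... | inj₂ 1≤x = ≤-trans x≤x² (≤-trans x²≤y y≤1+y)
    where
    y≤1+y : y ≤ 1# + y
    y≤1+y = ≤-respˡ-≈ (+-identityʳ y) (≤-respʳ-≈ (+-comm y 1#) (+-monoʳ-≤ y 0≤1))
    eq : x * (x - 1#) ≈ x * x - x
    eq = trans (distribˡ x x (- 1#))
           (+-congˡ (trans (sym (-‿distribʳ-* x 1#)) (-‿cong (*-identityʳ x))))
    x≤x² : x ≤ x * x
    x≤x² = 0≤y-x⇒x≤y
      (≤-respʳ-≈ eq (*-nonNegative (≤-trans 0≤1 1≤x) (x≤y⇒0≤y-x 1≤x)))

module Matrices (F : OrderedField) where
  open OrderedField F

  Matrix : ℕ → ℕ → Set
  Matrix n d = Fin n → Fin d → Carrier

  -- The elements of S, used as the index set of a matrix dimension.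
  El : ∀ {d} → Subset d → Set
  El {d} S = Σ[ j ∈ Fin d ] (j ∈ S)

  sumOver : ∀ {d} (S : Subset d) → (El S → Carrier) → Carrier
  sumOver {d} S f = sum (λ j → term j (j ∈? S))
    where
    term : (j : Fin d) → Dec (j ∈ S) → Carrier
    term j (yes j∈S) = f (j , j∈S)
    term j (no  _)   = 0#

  infix 9 _∣^_
  _∣^_ : ∀ {n d} → Matrix n d → (S : Subset d) → Fin n → El S → Carrier
  (A ∣^ S) i (j , _) = A i j

  mulOver : ∀ {n d e} (S : Subset d) →
            (Fin n → El S → Carrier) → (El S → Fin e → Carrier) → Matrix n e
  mulOver S B X i l = sumOver S (λ j → B i j * X j l)

  infixl 7 _*ᵥ_
  _*ᵥ_ : ∀ {n m} → Matrix n m → Vector Carrier m → Vector Carrier n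
  (B *ᵥ x) i = sum (λ j → B i j * x j)

  infixl 6 _-ᵥ_ _-ₘ_
  _-ᵥ_ : ∀ {n} → Vector Carrier n → Vector Carrier n → Vector Carrier n
  (u -ᵥ v) i = u i - v i

  _-ₘ_ : ∀ {n d} → Matrix n d → Matrix n d → Matrix n d
  (A -ₘ B) i j = A i j - B i j

  _∈span_ : ∀ {n r} → Vector Carrier n → (Fin r → Vector Carrier n) → Set
  _∈span_ {n} {r} w v =
    Σ[ c ∈ Vector Carrier r ] (∀ i → w i ≈ sum (λ j → c j * v j i))

  LinearlyIndependent : ∀ {n r} → (Fin r → Vector Carrier n) → Set
  LinearlyIndependent {n} {r} v =
    ∀ (c : Vector Carrier r) → (∀ i → sum (λ j → c j * v j i) ≈ 0#) → ∀ j → c j ≈ 0#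

  column : ∀ {n d} → Matrix n d → Fin d → Vector Carrier n
  column M j i = M i j

  -- The column space of M has a basis of r vectors.
  HasRank : ∀ {n d} → Matrix n d → ℕ → Set
  HasRank {n} {d} M r =
    Σ[ v ∈ (Fin r → Vector Carrier n) ]
      LinearlyIndependent v
      × (∀ l → v l ∈span column M)
      × (∀ j → column M j ∈span v)

  Rank≤ : ℕ → ∀ {n d} → Matrix n d → Set
  Rank≤ k M = Σ[ r ∈ ℕ ] (r ℕ.≤ k × HasRank M r)

  0ₘ : ∀ {n d} → Matrix n d
  0ₘ i j = 0#

  0ₘ-rank≤ : ∀ k {n d} → Rank≤ k (0ₘ {n} {d})
  0ₘ-rank≤ k = 0 , ℕ.z≤n , (λ ()) , (λ _ _ ()) , (λ ()) , (λ j → (λ ()) , (λ i → refl))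

  record Loss : Set where
    field
      fun         : Carrier → Carrier
      cong        : ∀ {x y} → x ≈ y → fun x ≈ fun y
      nonNegative : ∀ x → 0# ≤ fun x

  normᵥ : Loss → ∀ {n} → Vector Carrier n → Carrier
  normᵥ g v = sum (λ i → Loss.fun g (v i))

  norm : Loss → ∀ {n d} → Matrix n d → Carrier
  norm g M = sum (λ i → sum (λ j → Loss.fun g (M i j)))

  normᵥ-nonNegative : ∀ g {n} (v : Vector Carrier n) → 0# ≤ normᵥ g v
  normᵥ-nonNegative g v = sum-nonNegative _ (λ i → Loss.nonNegative g (v i))

  norm-nonNegative : ∀ g {n d} (M : Matrix n d) → 0# ≤ norm g M
  norm-nonNegative g M =
    sum-nonNegative _ (λ i → sum-nonNegative _ (λ j → Loss.nonNegative g (M i j)))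

  ApproxTriangle : Loss → ℕ → Carrier → Set
  ApproxTriangle g t ati =
    ∀ (x : Vector Carrier t) → fun (sum x) ≤ ati * sum (λ i → fun (x i))
    where open Loss g

  -- The growth condition is imposed wherever the quotient g(y)/g(x) is defined.
  LinearGrowth : Loss → Carrier → Set
  LinearGrowth g lin =
    ∀ x y → 0# < ∣ x ∣ → ∣ x ∣ ≤ ∣ y ∣ → ¬ (fun x ≈ 0#) →
    lin * (∣ y ∣ / ∣ x ∣) ≤ fun y / fun x
    where open Loss g

  RegressionSolver : ℕ → Set
  RegressionSolver n = ∀ m → Matrix n m → Vector Carrier n → Vector Carrier m

-- Dedekind completeness.  A complete ordered field is a model of ℝ, unique up
-- to isomorphism.

IsLub : (F : OrderedField) → let open OrderedField F in
        (Carrier → Set) → Carrier → Set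
IsLub F P u = (∀ x → P x → x ≤ u) × (∀ v → (∀ x → P x → x ≤ v) → u ≤ v)
  where open OrderedField F

Complete : OrderedField → Set₁
Complete F =
  ∀ (P : Carrier → Set) → ∃ P → (∃ λ b → ∀ x → P x → x ≤ b) → ∃ (IsLub F P)
  where open OrderedField F

module Reals (F : OrderedField) (complete : Complete F) where
  open OrderedField F
  open Matrices F

  √ : ∀ x → 0# ≤ x → Carrier
  √ x 0≤x = proj₁ (complete (λ y → y * y ≤ x)
    (0# , ≤-respˡ-≈ (sym (zeroˡ 0#)) 0≤x)
    (1# + x , λ y → x≤1+y 0≤x))

  √ℕ : ℕ → Carrier
  √ℕ n = √ (fromℕ n) (fromℕ-nonNegative n)

  -- The infimum of a nonnegative family over an inhabited index set, as the
  -- supremum of its lower bounds; it is the minimum whenever that is attained.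
  inf : {I : Set} (f : I → Carrier) → I → (∀ i → 0# ≤ f i) → Carrier
  inf f i₀ 0≤f = proj₁ (complete (λ z → ∀ i → z ≤ f i) (0# , 0≤f) (f i₀ , λ z p → p i₀))

  minRegression : Loss → ∀ {n m} → Matrix n m → Vector Carrier n → Carrier
  minRegression g B b =
    inf (λ x → normᵥ g (B *ᵥ x -ᵥ b)) (λ _ → 0#) (λ x → normᵥ-nonNegative g (B *ᵥ x -ᵥ b))

  minLowRank : Loss → ℕ → ∀ {n d} → Matrix n d → Carrier
  minLowRank g k {n} {d} A =
    inf {I = Σ (Matrix n d) (Rank≤ k)} (λ (Â , _) → norm g (A -ₘ Â))
      (0ₘ , 0ₘ-rank≤ k) (λ (Â , _) → norm-nonNegative g (A -ₘ Â))

  SolvesRegression : Loss → (ℕ → Carrier) → ∀ {n} → RegressionSolver n → Set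
  SolvesRegression g reg {n} solve =
    ∀ m (B : Matrix n m) (b : Vector Carrier n) →
    normᵥ g (B *ᵥ solve m B b -ᵥ b) ≤ reg m * minRegression g B b

-- An algorithm with oracle access to g and to a regression solver.  It may
-- compute with and compare field elements, but it has no access to suprema:
-- completeness is only available to its analysis.
ColumnSelectionAlgorithm : Set₁
ColumnSelectionAlgorithm =
  (F : OrderedField) → let open OrderedField F ; open Matrices F in
  (g : Carrier → Carrier) → ∀ {n d} → RegressionSolver n →
  (A : Matrix n d) (k : ℕ) → Σ[ S ∈ Subset d ] (El S → Fin d → Carrier)

module Submission where

-- Fix Â of rank at most k, let δ = A − Â and let the mass of column j be ‖δ_j‖_g.
--
-- Any family of vectors spanning at most k dimensions contains a list T of at most 3k members such
-- that each vector of the family is Σ_{i ∈ T} x_i u_i with Σ x_i² ≤ 1: take a basis together with 2k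
-- members that maximise det (Σ_{i ∈ T} u_i u_iᵀ).  By optimality under exchanging one member for
-- another, the leverage scores ℓ_j = u_jᵀ (Σ_{i ∈ T} u_i u_iᵀ)⁻¹ u_j satisfy ℓ_j (1 − ℓ_i) ≤ ℓ_i,
-- and the scores over T sum to the dimension, so all scores are at most 1; the minimum-norm
-- coefficients of u_j have square norm ℓ_j.  Then Σ |x_i| ≤ √(3k), so s = 3k is enough.
--
-- Applied to columns of Â of mass at most μ, this writes a_j − Σ x_i a_i as δ_j − Σ x_i δ_i, whose
-- loss is at most (ati / lin) (‖δ_j‖_g + √s μ).  Sort the columns by mass and cover the lower half
-- using lower-half columns only: its |L| terms √s μ are paid for by the upper half, all of whose
-- masses are at least μ.  Recursing on the upper half takes log d rounds, and the payments
-- telescope, so no logarithm enters the loss.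
--
-- The algorithm cannot see Â; it tries every list of O(s log d) columns with the regression solver.

open import Defs
open import Algebra.Bundles using (CommutativeRing)
import Algebra.Construct.NaturalChoice.Max as Max
import Algebra.Properties.AbelianGroup as AbelianGroupProperties
import Algebra.Properties.CommutativeMonoid.Sum as CommutativeMonoidSum
import Algebra.Properties.Monoid.Mult as Mult
import Algebra.Properties.Monoid.Mult.TCOptimised as MultTCO
import Algebra.Properties.Ring as RingProperties
import Algebra.Properties.Semiring.Mult.TCOptimised as SemiringMultTCO
import Algebra.Solver.Ring as RingSolver
open import Algebra.Solver.Ring.AlmostCommutativeRing
  using (fromCommutativeRing; _-Raw-AlmostCommutative⟶_)
open import Data.Bool.Base using (if_then_else_)
open import Data.Empty using (⊥-elim)
open import Data.Fin.Base as Fin using (Fin; zero; suc)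
import Data.Fin.Properties as Fin
open import Data.Fin.Subset as Subset using (Subset; _∪_; ⁅_⁆; inside; outside)
import Data.Fin.Subset.Properties as Subset
open import Data.Integer.Base as ℤ using (ℤ; +_; -[1+_]; _⊖_; 0ℤ)
import Data.Integer.Properties as ℤ
open import Data.List.Base as List
  using (List; []; _∷_; _++_; length; map; allFin; cartesianProductWith; replicate; lookup;
        take; drop; concatMap; upTo)
import Data.List.Extrema as Extrema
open import Data.List.Membership.Propositional using (_∈_; find; lose)
open import Data.List.Membership.Propositional.Properties
  using (∈-∃++; ∈-cartesianProductWith⁺; ∈-cartesianProductWith⁻; ∈-allFin; ∈-lookup; ∈-++⁺ˡ;
        ∈-++⁺ʳ; ∈-concatMap⁺; ∈-concatMap⁻; ∈-upTo⁺; ∈-upTo⁻)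
import Data.List.Properties as List
import Data.List.Relation.Binary.Permutation.Propositional as ↭
open import Data.List.Relation.Binary.Permutation.Propositional using (_↭_; prep; swap; ↭-sym)
import Data.List.Relation.Binary.Permutation.Propositional.Properties as ↭
open import Data.List.Relation.Unary.All as All using (All; []; _∷_)
open import Data.List.Relation.Unary.AllPairs using (AllPairs; []; _∷_)
import Data.List.Relation.Unary.AllPairs.Properties as AllPairs
open import Data.List.Relation.Unary.Any as Any using (here; there)
open import Data.List.Relation.Unary.Any.Properties using (lookup-index)
open import Data.List.Relation.Unary.Linked.Properties using (Linked⇒AllPairs)
import Data.List.Sort as Sort
open import Data.Maybe.Base as Maybe using (Maybe)
open import Data.Nat.Base as ℕ using (ℕ; zero; suc)
open import Data.Nat.Induction using (<-rec)
open import Data.Nat.Logarithm using (⌈log₂_⌉; ⌈log₂⌉-mono-≤; ⌈log₂⌈n/2⌉⌉≡⌈log₂n⌉∸1)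
import Data.Nat.Properties as ℕ
open import Data.Nat.Tactic.RingSolver using (solve-∀)
open import Data.Product.Base using (Σ-syntax; _×_; _,_; proj₁; proj₂)
open import Data.Sum.Base using (inj₁; inj₂)
open import Data.Vec.Base using ([]; _∷_)
import Data.Vec.Functional as Vector
open import Data.Vec.Functional using (Vector)
open import Function.Base using (_∘_; id)
open import Level using (0ℓ)
open import Relation.Binary.Bundles using (DecTotalOrder)
import Relation.Binary.Construct.On as On
open import Relation.Binary.PropositionalEquality as ≡ using (_≡_)
open import Relation.Binary.Structures using (IsDecTotalOrder)
open import Relation.Nullary using (¬_; Dec; yes; no; does)
open import Relation.Nullary.Decidable using (dec⇒maybe)

-- Ring solving in commutative rings, with integer coefficients.

module IntegerCoefficients (R : CommutativeRing 0ℓ 0ℓ) where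
  open CommutativeRing R
  open RingProperties ring using (-‿distribˡ-*; -‿distribʳ-*; -‿involutive; -0#≈0#)
  open AbelianGroupProperties +-abelianGroup using (⁻¹-∙-comm)
  open MultTCO +-monoid using (×-homo-+; 1+×) renaming (_×_ to _·_)
  open SemiringMultTCO semiring using (×1-homo-*)
  open import Relation.Binary.Reasoning.Setoid setoid

  -- Uses the form of multiples in which `1 · 1#` is `1#` by definition, so that `:1` and
  -- `con (+ 2)` denote exactly `1#` and `1# + 1#`.
  ⟦_⟧ : ℤ → Carrier
  ⟦ + n ⟧      = n · 1#
  ⟦ -[1+ n ] ⟧ = - (suc n · 1#)

  ⊖-homo : ∀ m n → ⟦ m ⊖ n ⟧ ≈ m · 1# - n · 1#
  ⊖-homo m zero = begin
    ⟦ m ⊖ 0 ⟧       ≡⟨ ≡.cong ⟦_⟧ (ℤ.⊖-≥ {m} ℕ.z≤n) ⟩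
    m · 1#          ≈⟨ +-identityʳ _ ⟨
    m · 1# + 0#     ≈⟨ +-congˡ -0#≈0# ⟨
    m · 1# - 0#     ∎
  ⊖-homo zero    (suc n) = sym (+-identityˡ _)
  ⊖-homo (suc m) (suc n) = begin
    ⟦ suc m ⊖ suc n ⟧                 ≡⟨ ≡.cong ⟦_⟧ (ℤ.[1+m]⊖[1+n]≡m⊖n m n) ⟩
    ⟦ m ⊖ n ⟧                         ≈⟨ ⊖-homo m n ⟩
    m · 1# - n · 1#                   ≈⟨ +-identityˡ _ ⟨
    0# + (m · 1# - n · 1#)            ≈⟨ +-congʳ (-‿inverseʳ 1#) ⟨
    1# - 1# + (m · 1# - n · 1#)       ≈⟨ +-assoc _ _ _ ⟩
    1# + (- 1# + (m · 1# - n · 1#))   ≈⟨ +-congˡ (+-assoc _ _ _) ⟨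
    1# + (- 1# + m · 1# - n · 1#)     ≈⟨ +-congˡ (+-congʳ (+-comm _ _)) ⟩
    1# + (m · 1# + - 1# - n · 1#)     ≈⟨ +-congˡ (+-assoc _ _ _) ⟩
    1# + (m · 1# + (- 1# - n · 1#))   ≈⟨ +-assoc _ _ _ ⟨
    1# + m · 1# + (- 1# - n · 1#)     ≈⟨ +-congˡ (⁻¹-∙-comm _ _) ⟩
    1# + m · 1# - (1# + n · 1#)       ≈⟨ +-cong (1+× m 1#) (-‿cong (1+× n 1#)) ⟨
    suc m · 1# - suc n · 1#           ∎

  +-homo : ∀ i j → ⟦ i ℤ.+ j ⟧ ≈ ⟦ i ⟧ + ⟦ j ⟧
  +-homo (+ m)      (+ n)      = ×-homo-+ 1# m n
  +-homo (+ m)      -[1+ n ]   = ⊖-homo m (suc n)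
  +-homo -[1+ m ]   (+ n)      = trans (⊖-homo n (suc m)) (+-comm _ _)
  +-homo -[1+ m ]   -[1+ n ]   = begin
    - (suc (suc (m ℕ.+ n)) · 1#)      ≡⟨ ≡.cong (λ l → - (suc l · 1#)) (ℕ.+-suc m n) ⟨
    - ((suc m ℕ.+ suc n) · 1#)        ≈⟨ -‿cong (×-homo-+ 1# (suc m) (suc n)) ⟩
    - (suc m · 1# + suc n · 1#)       ≈⟨ ⁻¹-∙-comm _ _ ⟨
    - (suc m · 1#) - suc n · 1#       ∎

  -‿homo : ∀ i → ⟦ ℤ.- i ⟧ ≈ - ⟦ i ⟧
  -‿homo (+ zero)  = sym -0#≈0#
  -‿homo (+ suc n) = refl
  -‿homo -[1+ n ]  = sym (-‿involutive _)

  pos-*-homo : ∀ m j → ⟦ + m ℤ.* j ⟧ ≈ ⟦ + m ⟧ * ⟦ j ⟧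
  pos-*-homo m (+ n) = begin
    ⟦ + m ℤ.* + n ⟧       ≡⟨ ≡.cong ⟦_⟧ (ℤ.pos-* m n) ⟨
    (m ℕ.* n) · 1#        ≈⟨ ×1-homo-* m n ⟩
    m · 1# * (n · 1#)     ∎
  pos-*-homo m -[1+ n ] = begin
    ⟦ + m ℤ.* -[1+ n ] ⟧          ≡⟨ ≡.cong ⟦_⟧ (ℤ.neg-distribʳ-* (+ m) (+ suc n)) ⟨
    ⟦ ℤ.- (+ m ℤ.* + suc n) ⟧     ≈⟨ -‿homo (+ m ℤ.* + suc n) ⟩
    - ⟦ + m ℤ.* + suc n ⟧         ≈⟨ -‿cong (pos-*-homo m (+ suc n)) ⟩
    - (m · 1# * (suc n · 1#))     ≈⟨ -‿distribʳ-* _ _ ⟩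
    m · 1# * - (suc n · 1#)       ∎

  *-homo : ∀ i j → ⟦ i ℤ.* j ⟧ ≈ ⟦ i ⟧ * ⟦ j ⟧
  *-homo (+ m)    j = pos-*-homo m j
  *-homo -[1+ m ] j = begin
    ⟦ -[1+ m ] ℤ.* j ⟧          ≡⟨ ≡.cong ⟦_⟧ (ℤ.neg-distribˡ-* (+ suc m) j) ⟨
    ⟦ ℤ.- (+ suc m ℤ.* j) ⟧     ≈⟨ -‿homo (+ suc m ℤ.* j) ⟩
    - ⟦ + suc m ℤ.* j ⟧         ≈⟨ -‿cong (pos-*-homo (suc m) j) ⟩
    - (suc m · 1# * ⟦ j ⟧)      ≈⟨ -‿distribˡ-* _ _ ⟩
    - (suc m · 1#) * ⟦ j ⟧      ∎

  morphism : ℤ.+-*-rawRing -Raw-AlmostCommutative⟶ fromCommutativeRing R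
  morphism = record
    { ⟦_⟧    = ⟦_⟧
    ; +-homo = +-homo
    ; *-homo = *-homo
    ; -‿homo = -‿homo
    ; 0-homo = refl
    ; 1-homo = refl
    }

  -- The solver asks only for a sound test, so comparing the integers suffices, even where distinct
  -- integers have equal images.
  _coeff≟_ : ∀ i j → Maybe (⟦ i ⟧ ≈ ⟦ j ⟧)
  i coeff≟ j = Maybe.map (λ eq → reflexive (≡.cong ⟦_⟧ eq)) (dec⇒maybe (i ℤ.≟ j))

  open RingSolver ℤ.+-*-rawRing (fromCommutativeRing R) morphism _coeff≟_ public
    using (Polynomial; solve; _:=_; _:+_; _:*_; :-_; _:-_; con)

  :1 : ∀ {n} → Polynomial n
  :1 = con (+ 1)

-- Order, inverses and absolute values in an ordered field.

module OrderedFieldProperties (F : OrderedField) where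
  open OrderedField F
  open IntegerCoefficients commutativeRing public
    using (solve; _:=_; _:+_; _:*_; :-_; _:-_; con; :1)
  open Max (DecTotalOrder.totalOrder decTotalOrder) using (x≤y⇒x⊔y≈y; x≤y⇒y⊔x≈y)
  open IsDecTotalOrder isDecTotalOrder public
    using (_≟_; ≤-resp-≈) renaming (antisym to ≤-antisym)
  open import Relation.Binary.Reasoning.PartialOrder (DecTotalOrder.poset decTotalOrder) public
  open Mult +-monoid using () renaming (×-homo-+ to ·-homo-+)

  ≰⇒≥ : ∀ {x y} → ¬ x ≤ y → y ≤ x
  ≰⇒≥ {x} {y} x≰y with total x y
  ... | inj₁ x≤y = ⊥-elim (x≰y x≤y)
  ... | inj₂ y≤x = y≤x

  ≰⇒> : ∀ {x y} → ¬ x ≤ y → y < x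
  ≰⇒> x≰y = ≰⇒≥ x≰y , λ y≈x → x≰y (≤-reflexive (sym y≈x))

  <⇒≱ : ∀ {x y} → x < y → ¬ y ≤ x
  <⇒≱ (x≤y , x≉y) y≤x = x≉y (≤-antisym x≤y y≤x)

  +-monoˡ-≤ : ∀ z {x y} → x ≤ y → x + z ≤ y + z
  +-monoˡ-≤ z {x} {y} x≤y = begin
    x + z  ≈⟨ +-comm x z ⟩
    z + x  ≤⟨ +-monoʳ-≤ z x≤y ⟩
    z + y  ≈⟨ +-comm z y ⟩
    y + z  ∎

  +-mono-≤ : ∀ {x y u v} → x ≤ y → u ≤ v → x + u ≤ y + v
  +-mono-≤ {y = y} {u} x≤y u≤v = ≤-trans (+-monoˡ-≤ u x≤y) (+-monoʳ-≤ y u≤v)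

  +-cancelʳ-≤ : ∀ z {x y} → x + z ≤ y + z → x ≤ y
  +-cancelʳ-≤ z {x} {y} p = begin
    x          ≈⟨ solve 2 (λ x z → x := x :+ z :- z) refl x z ⟩
    x + z - z  ≤⟨ +-monoˡ-≤ (- z) p ⟩
    y + z - z  ≈⟨ solve 2 (λ x z → x :+ z :- z := x) refl y z ⟩
    y          ∎

  x≤x+y : ∀ {x y} → 0# ≤ y → x ≤ x + y
  x≤x+y {x} 0≤y = ≤-respˡ-≈ (+-identityʳ x) (+-monoʳ-≤ x 0≤y)

  x≤y+x : ∀ {x y} → 0# ≤ y → x ≤ y + x
  x≤y+x {x} {y} 0≤y = ≤-respʳ-≈ (+-comm x y) (x≤x+y 0≤y)

  *-monoˡ-≤ : ∀ {z} → 0# ≤ z → ∀ {x y} → x ≤ y → z * x ≤ z * y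
  *-monoˡ-≤ {z} 0≤z {x} {y} x≤y = 0≤y-x⇒x≤y (begin
    0#             ≤⟨ *-nonNegative 0≤z (x≤y⇒0≤y-x x≤y) ⟩
    z * (y - x)    ≈⟨ solve 3 (λ x y z → z :* (y :- x) := z :* y :- z :* x) refl x y z ⟩
    z * y - z * x  ∎)

  *-monoʳ-≤ : ∀ {z} → 0# ≤ z → ∀ {x y} → x ≤ y → x * z ≤ y * z
  *-monoʳ-≤ {z} 0≤z {x} {y} x≤y =
    ≤-respˡ-≈ (*-comm z x) (≤-respʳ-≈ (*-comm z y) (*-monoˡ-≤ 0≤z x≤y))

  -‿anti-≤ : ∀ {x y} → x ≤ y → - y ≤ - x
  -‿anti-≤ {x} {y} x≤y = 0≤y-x⇒x≤y (begin
    0#         ≤⟨ x≤y⇒0≤y-x x≤y ⟩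
    y - x      ≈⟨ solve 2 (λ x y → y :- x := (:- x) :- (:- y)) refl x y ⟩
    - x - - y  ∎)

  x≤0⇒0≤-x : ∀ {x} → x ≤ 0# → 0# ≤ - x
  x≤0⇒0≤-x {x} x≤0 = ≤-respʳ-≈ (+-identityˡ (- x)) (x≤y⇒0≤y-x x≤0)

  0≤x⇒-x≤0 : ∀ {x} → 0# ≤ x → - x ≤ 0#
  0≤x⇒-x≤0 {x} 0≤x = 0≤y-x⇒x≤y (≤-respʳ-≈ (solve 1 (λ x → x := con ℤ.0ℤ :- (:- x)) refl x) 0≤x)

  square-nonNegative : ∀ x → 0# ≤ x * x
  square-nonNegative x with total 0# x
  ... | inj₁ 0≤x = *-nonNegative 0≤x 0≤x
  ... | inj₂ x≤0 = ≤-respʳ-≈ (solve 1 (λ x → (:- x) :* (:- x) := x :* x) refl x)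
                     (*-nonNegative (x≤0⇒0≤-x x≤0) (x≤0⇒0≤-x x≤0))

  0<1 : 0# < 1#
  0<1 = 0≤1 , 0≉1

  >⇒≉ : ∀ {x} → 0# < x → ¬ x ≈ 0#
  >⇒≉ (_ , 0≉x) x≈0 = 0≉x (sym x≈0)

  <-≤-trans : ∀ {x y z} → x < y → y ≤ z → x < z
  <-≤-trans (x≤y , x≉y) y≤z =
    ≤-trans x≤y y≤z , λ x≈z → x≉y (≤-antisym x≤y (≤-respʳ-≈ (sym x≈z) y≤z))

  ⁻¹-inverseˡ : ∀ {x} → ¬ x ≈ 0# → x ⁻¹ * x ≈ 1#
  ⁻¹-inverseˡ {x} x≉0 = trans (*-comm (x ⁻¹) x) (⁻¹-inverseʳ x≉0)

  ⁻¹-nonNegative : ∀ {x} → 0# < x → 0# ≤ x ⁻¹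
  ⁻¹-nonNegative {x} 0<x@(0≤x , _) with total 0# (x ⁻¹)
  ... | inj₁ 0≤x⁻¹ = 0≤x⁻¹
  ... | inj₂ x⁻¹≤0 = ⊥-elim (<⇒≱ 0<1 (begin
    1#        ≈⟨ ⁻¹-inverseʳ (>⇒≉ 0<x) ⟨
    x * x ⁻¹  ≤⟨ *-monoˡ-≤ 0≤x x⁻¹≤0 ⟩
    x * 0#    ≈⟨ zeroʳ x ⟩
    0#        ∎))

  x⁻¹*[x*y]≈y : ∀ {x} → ¬ x ≈ 0# → ∀ y → x ⁻¹ * (x * y) ≈ y
  x⁻¹*[x*y]≈y {x} x≉0 y = begin-equality
    x ⁻¹ * (x * y)  ≈⟨ *-assoc _ _ _ ⟨
    x ⁻¹ * x * y    ≈⟨ *-congʳ (⁻¹-inverseˡ x≉0) ⟩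
    1# * y          ≈⟨ *-identityˡ y ⟩
    y               ∎

  *-cancelˡ-≤ : ∀ {z} → 0# < z → ∀ {x y} → z * x ≤ z * y → x ≤ y
  *-cancelˡ-≤ {z} 0<z {x} {y} zx≤zy = begin
    x               ≈⟨ x⁻¹*[x*y]≈y (>⇒≉ 0<z) x ⟨
    z ⁻¹ * (z * x)  ≤⟨ *-monoˡ-≤ (⁻¹-nonNegative 0<z) zx≤zy ⟩
    z ⁻¹ * (z * y)  ≈⟨ x⁻¹*[x*y]≈y (>⇒≉ 0<z) y ⟩
    y               ∎

  *-≉0 : ∀ {x y} → ¬ x ≈ 0# → ¬ y ≈ 0# → ¬ x * y ≈ 0#
  *-≉0 {x} {y} x≉0 y≉0 xy≈0 = y≉0 (begin-equality
    y               ≈⟨ x⁻¹*[x*y]≈y x≉0 y ⟨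
    x ⁻¹ * (x * y)  ≈⟨ *-congˡ xy≈0 ⟩
    x ⁻¹ * 0#       ≈⟨ zeroʳ _ ⟩
    0#              ∎)

  *-positive : ∀ {x y} → 0# < x → 0# < y → 0# < x * y
  *-positive 0<x@(0≤x , _) 0<y@(0≤y , _) =
    *-nonNegative 0≤x 0≤y , λ 0≈xy → *-≉0 (>⇒≉ 0<x) (>⇒≉ 0<y) (sym 0≈xy)

  0≤x⇒∣x∣≈x : ∀ {x} → 0# ≤ x → ∣ x ∣ ≈ x
  0≤x⇒∣x∣≈x 0≤x = x≤y⇒y⊔x≈y (≤-trans (0≤x⇒-x≤0 0≤x) 0≤x)

  x≤0⇒∣x∣≈-x : ∀ {x} → x ≤ 0# → ∣ x ∣ ≈ - x
  x≤0⇒∣x∣≈-x x≤0 = x≤y⇒x⊔y≈y (≤-trans x≤0 (x≤0⇒0≤-x x≤0))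

  ∣x∣-nonNegative : ∀ x → 0# ≤ ∣ x ∣
  ∣x∣-nonNegative x with total 0# x
  ... | inj₁ 0≤x = ≤-respʳ-≈ (sym (0≤x⇒∣x∣≈x 0≤x)) 0≤x
  ... | inj₂ x≤0 = ≤-respʳ-≈ (sym (x≤0⇒∣x∣≈-x x≤0)) (x≤0⇒0≤-x x≤0)

  ∣-∣-cong : ∀ {x y} → x ≈ y → ∣ x ∣ ≈ ∣ y ∣
  ∣-∣-cong {x} {y} x≈y with total 0# x
  ... | inj₁ 0≤x = trans (0≤x⇒∣x∣≈x 0≤x) (trans x≈y (sym (0≤x⇒∣x∣≈x (≤-respʳ-≈ x≈y 0≤x))))
  ... | inj₂ x≤0 = trans (x≤0⇒∣x∣≈-x x≤0)
                     (trans (-‿cong x≈y) (sym (x≤0⇒∣x∣≈-x (≤-respˡ-≈ x≈y x≤0))))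

  ∣-x∣≈∣x∣ : ∀ x → ∣ - x ∣ ≈ ∣ x ∣
  ∣-x∣≈∣x∣ x with total 0# x
  ... | inj₁ 0≤x = begin-equality
    ∣ - x ∣  ≈⟨ x≤0⇒∣x∣≈-x (0≤x⇒-x≤0 0≤x) ⟩
    - - x    ≈⟨ solve 1 (λ x → :- (:- x) := x) refl x ⟩
    x        ≈⟨ 0≤x⇒∣x∣≈x 0≤x ⟨
    ∣ x ∣    ∎
  ... | inj₂ x≤0 = trans (0≤x⇒∣x∣≈x (x≤0⇒0≤-x x≤0)) (sym (x≤0⇒∣x∣≈-x x≤0))

  ∣x∣*∣x∣≈x*x : ∀ x → ∣ x ∣ * ∣ x ∣ ≈ x * x
  ∣x∣*∣x∣≈x*x x with total 0# x
  ... | inj₁ 0≤x = *-cong (0≤x⇒∣x∣≈x 0≤x) (0≤x⇒∣x∣≈x 0≤x)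
  ... | inj₂ x≤0 = trans (*-cong (x≤0⇒∣x∣≈-x x≤0) (x≤0⇒∣x∣≈-x x≤0))
                     (solve 1 (λ x → (:- x) :* (:- x) := x :* x) refl x)

  private
    ∣xy∣≈x∣y∣ : ∀ {x} y → 0# ≤ x → ∣ x * y ∣ ≈ x * ∣ y ∣
    ∣xy∣≈x∣y∣ {x} y 0≤x with total 0# y
    ... | inj₁ 0≤y = trans (0≤x⇒∣x∣≈x (*-nonNegative 0≤x 0≤y)) (*-congˡ (sym (0≤x⇒∣x∣≈x 0≤y)))
    ... | inj₂ y≤0 = begin-equality
      ∣ x * y ∣  ≈⟨ x≤0⇒∣x∣≈-x (≤-respʳ-≈ (zeroʳ x) (*-monoˡ-≤ 0≤x y≤0)) ⟩
      - (x * y)  ≈⟨ solve 2 (λ x y → :- (x :* y) := x :* (:- y)) refl x y ⟩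
      x * - y    ≈⟨ *-congˡ (x≤0⇒∣x∣≈-x y≤0) ⟨
      x * ∣ y ∣  ∎

  ∣xy∣≈∣x∣∣y∣ : ∀ x y → ∣ x * y ∣ ≈ ∣ x ∣ * ∣ y ∣
  ∣xy∣≈∣x∣∣y∣ x y with total 0# x
  ... | inj₁ 0≤x = trans (∣xy∣≈x∣y∣ y 0≤x) (*-congʳ (sym (0≤x⇒∣x∣≈x 0≤x)))
  ... | inj₂ x≤0 = begin-equality
    ∣ x * y ∣      ≈⟨ ∣-x∣≈∣x∣ (x * y) ⟨
    ∣ - (x * y) ∣  ≈⟨ ∣-∣-cong (solve 2 (λ x y → :- (x :* y) := (:- x) :* y) refl x y) ⟩
    ∣ - x * y ∣    ≈⟨ ∣xy∣≈x∣y∣ y (x≤0⇒0≤-x x≤0) ⟩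
    - x * ∣ y ∣    ≈⟨ *-congʳ (x≤0⇒∣x∣≈-x x≤0) ⟨
    ∣ x ∣ * ∣ y ∣  ∎

  x≉0⇒0<∣x∣ : ∀ {x} → ¬ x ≈ 0# → 0# < ∣ x ∣
  x≉0⇒0<∣x∣ {x} x≉0 = ∣x∣-nonNegative x , λ 0≈∣x∣ → *-≉0 x≉0 x≉0 (begin-equality
    x * x          ≈⟨ ∣x∣*∣x∣≈x*x x ⟨
    ∣ x ∣ * ∣ x ∣  ≈⟨ *-congʳ 0≈∣x∣ ⟨
    0# * ∣ x ∣     ≈⟨ zeroˡ _ ⟩
    0#             ∎)

  x*x≤1⇒∣x∣≤1 : ∀ {x} → x * x ≤ 1# → ∣ x ∣ ≤ 1#
  x*x≤1⇒∣x∣≤1 {x} x²≤1 with ∣ x ∣ ≤? 1#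
  ... | yes ∣x∣≤1 = ∣x∣≤1
  ... | no  ∣x∣≰1 = begin
    ∣ x ∣          ≈⟨ *-identityʳ _ ⟨
    ∣ x ∣ * 1#     ≤⟨ *-monoˡ-≤ (∣x∣-nonNegative x) (≰⇒≥ ∣x∣≰1) ⟩
    ∣ x ∣ * ∣ x ∣  ≈⟨ ∣x∣*∣x∣≈x*x x ⟩
    x * x          ≤⟨ x²≤1 ⟩
    1#             ∎

  fromℕ-+ : ∀ m n → fromℕ (m ℕ.+ n) ≈ fromℕ m + fromℕ n
  fromℕ-+ = ·-homo-+ 1#

  fromℕ-mono-≤ : ∀ {m n} → m ℕ.≤ n → fromℕ m ≤ fromℕ n
  fromℕ-mono-≤ {n = n} ℕ.z≤n = fromℕ-nonNegative n
  fromℕ-mono-≤ (ℕ.s≤s m≤n) = +-monoʳ-≤ 1# (fromℕ-mono-≤ m≤n)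

  fromℕ-positive : ∀ {n} → 1 ℕ.≤ n → 0# < fromℕ n
  fromℕ-positive {n} 1≤n = <-≤-trans 0<1 (begin
    1#       ≈⟨ +-identityʳ 1# ⟨
    fromℕ 1  ≤⟨ fromℕ-mono-≤ 1≤n ⟩
    fromℕ n  ∎)

-- Finite sums over lists, up to the Cauchy-Schwarz inequality.

module ListSums (F : OrderedField) where
  open OrderedField F
  open OrderedFieldProperties F

  -- Index lists may repeat an element, which then counts with multiplicity; the tuples compared in
  -- the exchange argument can have repetitions.
  Σ : {I : Set} → List I → (I → Carrier) → Carrier
  Σ []       f = 0#
  Σ (x ∷ xs) f = f x + Σ xs f

  module _ {I : Set} where

    Σ-cong-∈ : ∀ (xs : List I) {f g : I → Carrier} →
               (∀ {x} → x ∈ xs → f x ≈ g x) → Σ xs f ≈ Σ xs g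
    Σ-cong-∈ []       f≈g = refl
    Σ-cong-∈ (x ∷ xs) f≈g = +-cong (f≈g (here ≡.refl)) (Σ-cong-∈ xs (f≈g ∘ there))

    Σ-cong : ∀ (xs : List I) {f g : I → Carrier} → (∀ x → f x ≈ g x) → Σ xs f ≈ Σ xs g
    Σ-cong xs f≈g = Σ-cong-∈ xs (λ {x} _ → f≈g x)

    Σ-mono-∈ : ∀ (xs : List I) {f g : I → Carrier} →
               (∀ {x} → x ∈ xs → f x ≤ g x) → Σ xs f ≤ Σ xs g
    Σ-mono-∈ []       f≤g = ≤-refl
    Σ-mono-∈ (x ∷ xs) f≤g = +-mono-≤ (f≤g (here ≡.refl)) (Σ-mono-∈ xs (f≤g ∘ there))

    Σ-mono : ∀ (xs : List I) {f g : I → Carrier} → (∀ x → f x ≤ g x) → Σ xs f ≤ Σ xs g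
    Σ-mono xs f≤g = Σ-mono-∈ xs (λ {x} _ → f≤g x)

    Σ-nonNegative : ∀ (xs : List I) {f : I → Carrier} → (∀ x → 0# ≤ f x) → 0# ≤ Σ xs f
    Σ-nonNegative []       0≤f = ≤-refl
    Σ-nonNegative (x ∷ xs) 0≤f = +-nonNegative (0≤f x) (Σ-nonNegative xs 0≤f)

    Σ-zero : ∀ (xs : List I) → Σ xs (λ _ → 0#) ≈ 0#
    Σ-zero []       = refl
    Σ-zero (x ∷ xs) = trans (+-identityˡ _) (Σ-zero xs)

    Σ-const : ∀ (xs : List I) c → Σ xs (λ _ → c) ≈ fromℕ (length xs) * c
    Σ-const []       c = sym (zeroˡ c)
    Σ-const (x ∷ xs) c = begin-equality
      c + Σ xs (λ _ → c)            ≈⟨ +-congˡ (Σ-const xs c) ⟩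
      c + fromℕ (length xs) * c     ≈⟨ solve 2 (λ c n → c :+ n :* c := (:1 :+ n) :* c) refl c _ ⟩
      fromℕ (suc (length xs)) * c   ∎

    Σ-+ : ∀ (xs : List I) f g → Σ xs (λ x → f x + g x) ≈ Σ xs f + Σ xs g
    Σ-+ []       f g = sym (+-identityˡ 0#)
    Σ-+ (x ∷ xs) f g = begin-equality
      f x + g x + Σ xs (λ x → f x + g x)  ≈⟨ +-congˡ (Σ-+ xs f g) ⟩
      f x + g x + (Σ xs f + Σ xs g)
        ≈⟨ solve 4 (λ a b c d → a :+ b :+ (c :+ d) := a :+ c :+ (b :+ d)) refl _ _ _ _ ⟩
      f x + Σ xs f + (g x + Σ xs g)       ∎

    Σ-*ˡ : ∀ (xs : List I) c f → Σ xs (λ x → c * f x) ≈ c * Σ xs f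
    Σ-*ˡ []       c f = sym (zeroʳ c)
    Σ-*ˡ (x ∷ xs) c f = trans (+-congˡ (Σ-*ˡ xs c f)) (sym (distribˡ c _ _))

    Σ-*ʳ : ∀ (xs : List I) c f → Σ xs (λ x → f x * c) ≈ Σ xs f * c
    Σ-*ʳ xs c f = begin-equality
      Σ xs (λ x → f x * c)  ≈⟨ Σ-cong xs (λ x → *-comm (f x) c) ⟩
      Σ xs (λ x → c * f x)  ≈⟨ Σ-*ˡ xs c f ⟩
      c * Σ xs f            ≈⟨ *-comm c _ ⟩
      Σ xs f * c            ∎

    Σ-neg : ∀ (xs : List I) f → Σ xs (λ x → - f x) ≈ - Σ xs f
    Σ-neg []       f = solve 0 (con 0ℤ := :- con 0ℤ) refl
    Σ-neg (x ∷ xs) f = trans (+-congˡ (Σ-neg xs f))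
                         (solve 2 (λ a b → (:- a) :+ (:- b) := :- (a :+ b)) refl _ _)

    Σ-- : ∀ (xs : List I) f g → Σ xs (λ x → f x - g x) ≈ Σ xs f - Σ xs g
    Σ-- xs f g = trans (Σ-+ xs f (λ x → - g x)) (+-congˡ (Σ-neg xs g))

    Σ-++ : ∀ (xs ys : List I) f → Σ (xs ++ ys) f ≈ Σ xs f + Σ ys f
    Σ-++ []       ys f = sym (+-identityˡ _)
    Σ-++ (x ∷ xs) ys f = trans (+-congˡ (Σ-++ xs ys f)) (sym (+-assoc _ _ _))

    Σ-↭ : ∀ {xs ys : List I} → xs ↭ ys → ∀ f → Σ xs f ≈ Σ ys f
    Σ-↭ ↭.refl           f = refl
    Σ-↭ (prep x xs↭ys)   f = +-congˡ (Σ-↭ xs↭ys f)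
    Σ-↭ (swap x y xs↭ys) f = trans (+-congˡ (+-congˡ (Σ-↭ xs↭ys f)))
      (solve 3 (λ a b c → a :+ (b :+ c) := b :+ (a :+ c)) refl _ _ _)
    Σ-↭ (↭.trans p q)    f = trans (Σ-↭ p f) (Σ-↭ q f)

  Σ-swap : ∀ {I J : Set} (xs : List I) (ys : List J) (f : I → J → Carrier) →
           Σ xs (λ x → Σ ys (f x)) ≈ Σ ys (λ y → Σ xs (λ x → f x y))
  Σ-swap []       ys f = sym (Σ-zero ys)
  Σ-swap (x ∷ xs) ys f = begin-equality
    Σ ys (f x) + Σ xs (λ x → Σ ys (f x))          ≈⟨ +-congˡ (Σ-swap xs ys f) ⟩
    Σ ys (f x) + Σ ys (λ y → Σ xs (λ x → f x y))  ≈⟨ Σ-+ ys _ _ ⟨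
    Σ ys (λ y → f x y + Σ xs (λ x → f x y))       ∎

  Σ-map : ∀ {I J : Set} (h : I → J) (xs : List I) f → Σ (map h xs) f ≈ Σ xs (f ∘ h)
  Σ-map h []       f = refl
  Σ-map h (x ∷ xs) f = +-congˡ (Σ-map h xs f)

  sum≈Σ-tabulate : ∀ {I : Set} {n} (h : Fin n → I) (f : I → Carrier) →
                   sum (f ∘ h) ≈ Σ (List.tabulate h) f
  sum≈Σ-tabulate {n = zero}  h f = refl
  sum≈Σ-tabulate {n = suc n} h f = +-congˡ (sum≈Σ-tabulate (h ∘ suc) f)

  sum≈Σ : ∀ {n} (f : Fin n → Carrier) → sum f ≈ Σ (allFin n) f
  sum≈Σ = sum≈Σ-tabulate id

  Σ-member-≤ : ∀ {I : Set} {xs : List I} {f} → (∀ x → 0# ≤ f x) → ∀ {x} → x ∈ xs → f x ≤ Σ xs f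
  Σ-member-≤ {xs = _ ∷ xs} 0≤f (here ≡.refl) = x≤x+y (Σ-nonNegative xs 0≤f)
  Σ-member-≤ 0≤f (there x∈xs) = ≤-trans (Σ-member-≤ 0≤f x∈xs) (x≤y+x (0≤f _))

  -- By summing (n f x − Σ xs f)² ≥ 0 over xs.
  Σ-cauchySchwarz : ∀ {I : Set} (xs : List I) n → length xs ℕ.≤ n → ∀ f →
                    Σ xs f * Σ xs f ≤ fromℕ n * Σ xs (λ x → f x * f x)
  -- For n = 0 there is no positive factor to cancel, but then the list is empty.
  Σ-cauchySchwarz xs zero len≤n f with xs
  ... | [] = ≤-reflexive (solve 0 (con 0ℤ :* con 0ℤ := con 0ℤ :* con 0ℤ) refl)
  Σ-cauchySchwarz xs n@(suc _) len≤n f = *-cancelˡ-≤ (fromℕ-positive {n} (ℕ.s≤s ℕ.z≤n)) (begin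
    N * (y * y)
      ≈⟨ solve 2 (λ N y → N :* (y :* y) := con (+ 2) :* (N :* y :* y) :- N :* (y :* y)) refl N y ⟩
    two * (N * y * y) - N * (y * y)
      ≤⟨ +-monoʳ-≤ _ (-‿anti-≤ (*-monoʳ-≤ (square-nonNegative y) (fromℕ-mono-≤ len≤n))) ⟩
    two * (N * y * y) - fromℕ (length xs) * (y * y)
      ≤⟨ 0≤y-x⇒x≤y (begin
          0#
            ≤⟨ Σ-nonNegative xs (λ x → square-nonNegative (N * f x - y)) ⟩
          Σ xs (λ x → (N * f x - y) * (N * f x - y))
            ≈⟨ Σ-cong xs (λ x → solve 3 (λ N a y → (N :* a :- y) :* (N :* a :- y) :=
                 N :* N :* (a :* a) :+ (:- (con (+ 2) :* (N :* y))) :* a :+ y :* y) refl N (f x) y) ⟩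
          Σ xs (λ x → N * N * (f x * f x) + - (two * (N * y)) * f x + y * y)
            ≈⟨ trans (Σ-+ xs _ _) (+-cong (trans (Σ-+ xs _ _) (+-cong (Σ-*ˡ xs _ _) (Σ-*ˡ xs _ _))) (Σ-const xs _)) ⟩
          N * N * q + - (two * (N * y)) * y + fromℕ (length xs) * (y * y)
            ≈⟨ solve 4 (λ N q y l → N :* N :* q :+ (:- (con (+ 2) :* (N :* y))) :* y :+ l :* (y :* y) :=
                 N :* (N :* q) :- (con (+ 2) :* (N :* y :* y) :- l :* (y :* y))) refl N q y (fromℕ (length xs)) ⟩
          N * (N * q) - (two * (N * y * y) - fromℕ (length xs) * (y * y)) ∎) ⟩
    N * (N * q) ∎)
    where
    N = fromℕ n
    y = Σ xs f
    q = Σ xs (λ x → f x * f x)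
    two = 1# + 1#

-- Gram kernels of vector families and their rank-one updates.

module ReproducingKernels (F : OrderedField) {I : Set} where
  open OrderedField F
  open OrderedFieldProperties F
  open ListSums F

  -- The values of φ on T determine φ through K. When φ runs over the coordinate functions of
  -- vectors u, this reads u_j = Σ_{i ∈ T} K i j u_i: column j of K holds the coefficients of u_j.
  Reproduces : List I → (I → I → Carrier) → (I → Carrier) → Set
  Reproduces T K φ = ∀ j → φ j ≈ Σ T (λ i → φ i * K i j)

  reproduces-− : ∀ {T K φ ψ} → Reproduces T K φ → Reproduces T K ψ → ∀ c →
                 Reproduces T K (λ j → φ j - c * ψ j)
  reproduces-− {T} {K} {φ} {ψ} φ∈ ψ∈ c j = begin-equality
    φ j - c * ψ j
      ≈⟨ +-cong (φ∈ j) (-‿cong (*-congˡ (ψ∈ j))) ⟩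
    Σ T (λ i → φ i * K i j) - c * Σ T (λ i → ψ i * K i j)
      ≈⟨ +-congˡ (-‿cong (Σ-*ˡ T c _)) ⟨
    Σ T (λ i → φ i * K i j) - Σ T (λ i → c * (ψ i * K i j))
      ≈⟨ Σ-- T _ _ ⟨
    Σ T (λ i → φ i * K i j - c * (ψ i * K i j))
      ≈⟨ Σ-cong T (λ i → solve 4 (λ a c b k → a :* k :- c :* (b :* k) := (a :- c :* b) :* k) refl _ _ _ _) ⟩
    Σ T (λ i → (φ i - c * ψ i) * K i j) ∎

  trace : List I → (I → I → Carrier) → Carrier
  trace T K = Σ T (λ i → K i i)

  -- K is the Gram kernel u_aᵀ M⁻¹ u_b, M = Σ_{i ∈ T} u_i u_iᵀ, of a family of vectors u
  -- whose coordinate functions span Φ.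
  record IsKernel (Φ : (I → Carrier) → Set) (T : List I) (K : I → I → Carrier) : Set where
    field
      K-sym      : ∀ a b → K a b ≈ K b a
      member     : ∀ a → Φ (K a)
      reproduces : ∀ {φ} → Φ φ → Reproduces T K φ

    -- The reproducing property of the function `K a`, evaluated at a itself. It identifies the
    -- square norm of the coefficients of u_a with the leverage score of a.
    squares : ∀ a → Σ T (λ i → K i a * K i a) ≈ K a a
    squares a = begin-equality
      Σ T (λ i → K i a * K i a)  ≈⟨ Σ-cong T (λ i → *-congʳ (K-sym i a)) ⟩
      Σ T (λ i → K a i * K i a)  ≈⟨ reproduces (member a) a ⟨
      K a a                      ∎

    diagonal-nonNegative : ∀ a → 0# ≤ K a a
    diagonal-nonNegative a =
      ≤-respʳ-≈ (squares a) (Σ-nonNegative T (λ i → square-nonNegative (K i a)))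

    0<1+diagonal : ∀ a → 0# < 1# + K a a
    0<1+diagonal a = <-≤-trans 0<1 (x≤x+y (diagonal-nonNegative a))

  -- Both values equal Σ_i K a i · K′ i b, since each kernel reproduces the functions of the other.
  -- Hence a kernel depends on its list only up to order.
  kernel-unique : ∀ {Φ T T′ K K′} → IsKernel Φ T K → IsKernel Φ T′ K′ →
                  (∀ f → Σ T f ≈ Σ T′ f) → ∀ a b → K a b ≈ K′ a b
  kernel-unique {T = T} {T′} {K} {K′} isK isK′ Σ≈ a b = begin-equality
    K a b                       ≈⟨ K′.reproduces (K.member a) b ⟩
    Σ T′ (λ i → K a i * K′ i b)  ≈⟨ Σ≈ _ ⟨
    Σ T (λ i → K a i * K′ i b)
      ≈⟨ Σ-cong T (λ i → trans (*-comm _ _) (*-cong (K′.K-sym i b) (K.K-sym a i))) ⟩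
    Σ T (λ i → K′ b i * K i a)   ≈⟨ K.reproduces (K′.member b) a ⟨
    K′ b a                      ≈⟨ K′.K-sym b a ⟩
    K′ a b                      ∎
    where
    module K  = IsKernel isK
    module K′ = IsKernel isK′

  -- The Sherman–Morrison formula for M + u_p u_pᵀ.
  extend : I → (I → I → Carrier) → I → I → Carrier
  extend p K a b = K a b - (K a p * (1# + K p p) ⁻¹) * K p b

  module _ {Φ : (I → Carrier) → Set} {T K} (isK : IsKernel Φ T K) (p : I) where
    open IsKernel isK

    private
      β = (1# + K p p) ⁻¹

      βK≈1-β : β * K p p ≈ 1# - β
      βK≈1-β = begin-equality
        β * K p p             ≈⟨ solve 2 (λ β k → β :* k := β :* (:1 :+ k) :- β) refl β (K p p) ⟩
        β * (1# + K p p) - β  ≈⟨ +-congʳ (⁻¹-inverseˡ (>⇒≉ (0<1+diagonal p))) ⟩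
        1# - β                ∎

    extend-pivot : ∀ b → extend p K p b ≈ β * K p b
    extend-pivot b = begin-equality
      K p b - K p p * β * K p b
        ≈⟨ solve 3 (λ x k β → x :- k :* β :* x := x :- β :* k :* x) refl (K p b) (K p p) β ⟩
      K p b - β * K p p * K p b    ≈⟨ +-congˡ (-‿cong (*-congʳ βK≈1-β)) ⟩
      K p b - (1# - β) * K p b     ≈⟨ solve 2 (λ x β → x :- (:1 :- β) :* x := β :* x) refl (K p b) β ⟩
      β * K p b                    ∎

    -- The score of p after p is added still determines 1 + K p p, the factor by which adding p
    -- multiplies the determinant.
    1-extend-pivot : 1# - extend p K p p ≈ β
    1-extend-pivot = begin-equality
      1# - extend p K p p  ≈⟨ +-congˡ (-‿cong (trans (extend-pivot p) βK≈1-β)) ⟩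
      1# - (1# - β)        ≈⟨ solve 1 (λ β → :1 :- (:1 :- β) := β) refl β ⟩
      β                    ∎

    -- M + u_p u_pᵀ dominates M, so its inverse is dominated by that of M and no leverage score
    -- grows.
    extend-diagonal-≤ : ∀ a → extend p K a a ≤ K a a
    extend-diagonal-≤ a = begin
      K a a - K a p * β * K p a    ≈⟨ +-congˡ (-‿cong (*-congˡ (K-sym p a))) ⟩
      K a a - K a p * β * K a p
        ≈⟨ solve 3 (λ x y β → x :- y :* β :* y := x :- β :* (y :* y)) refl (K a a) (K a p) β ⟩
      K a a - β * (K a p * K a p)
        ≤⟨ +-monoʳ-≤ _ (0≤x⇒-x≤0 (*-nonNegative (⁻¹-nonNegative (0<1+diagonal p)) (square-nonNegative _))) ⟩
      K a a + 0#                   ≈⟨ +-identityʳ _ ⟩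
      K a a                        ∎

    -- The term of the new point p restores exactly what the correction takes from the sum over T.
    -- The function space Φ is unchanged, because T already determines its members.
    extend-isKernel : (∀ {φ ψ} → Φ φ → Φ ψ → ∀ c → Φ (λ j → φ j - c * ψ j)) →
                      IsKernel Φ (p ∷ T) (extend p K)
    extend-isKernel Φ-− = record
      { K-sym      = λ a b → +-cong (K-sym a b) (-‿cong (trans (*-cong (*-congʳ (K-sym a p)) (K-sym p b))
                       (solve 3 (λ x y β → x :* β :* y := y :* β :* x) refl _ _ _)))
      ; member     = λ a → Φ-− (member a) (member p) _
      ; reproduces = λ {φ} Φφ j → sym (begin-equality
          φ p * extend p K p j + Σ T (λ i → φ i * extend p K i j)
            ≈⟨ +-congˡ (Σ-cong T (λ i → solve 5 (λ f x y β z → f :* (x :- y :* β :* z) := f :* x :- β :* z :* (f :* y))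
                 refl _ _ _ _ _)) ⟩
          φ p * extend p K p j + Σ T (λ i → φ i * K i j - β * K p j * (φ i * K i p))
            ≈⟨ +-cong (*-congˡ (extend-pivot j)) (trans (Σ-- T _ _) (+-congˡ (-‿cong (Σ-*ˡ T _ _)))) ⟩
          φ p * (β * K p j) + (Σ T (λ i → φ i * K i j) - β * K p j * Σ T (λ i → φ i * K i p))
            ≈⟨ +-congˡ (+-cong (reproduces Φφ j) (-‿cong (*-congˡ (reproduces Φφ p)))) ⟨
          φ p * (β * K p j) + (φ j - β * K p j * φ p)
            ≈⟨ solve 3 (λ f x y → f :* x :+ (y :- x :* f) := y) refl (φ p) (β * K p j) (φ j) ⟩
          φ j ∎)
      }

    -- The new point has score β · K p p, and by `squares` the old scores lose β Σ (K i p)² = β · K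
    -- p p in total. The trace is thus an invariant, namely the dimension.
    extend-trace : trace (p ∷ T) (extend p K) ≈ trace T K
    extend-trace = begin-equality
      extend p K p p + Σ T (λ i → K i i - K i p * β * K p i)
        ≈⟨ +-cong (extend-pivot p) (trans (Σ-cong T (λ i → +-congˡ (-‿cong (trans (*-congˡ (K-sym p i))
             (solve 2 (λ x β → x :* β :* x := β :* (x :* x)) refl (K i p) β))))) (Σ-- T _ _)) ⟩
      β * K p p + (trace T K - Σ T (λ i → β * (K i p * K i p)))
        ≈⟨ +-congˡ (+-congˡ (-‿cong (trans (Σ-*ˡ T β _) (*-congˡ (squares p))))) ⟩
      β * K p p + (trace T K - β * K p p)
        ≈⟨ solve 2 (λ x t → x :+ (t :- x) := t) refl _ _ ⟩
      trace T K ∎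

  -- Volume maximisation and leverage scores.

  module Volume
    (Φ : (I → Carrier) → Set)
    (Φ-− : ∀ {φ ψ} → Φ φ → Φ ψ → ∀ c → Φ (λ j → φ j - c * ψ j))
    (P : List I) (K₀ : I → I → Carrier) (isK₀ : IsKernel Φ P K₀)
    where

    -- The Gram kernel of `S ++ P`. The basis P stays in the list throughout, so the Gram matrix is
    -- invertible whatever S is.
    kernel : List I → I → I → Carrier
    kernel []      = K₀
    kernel (p ∷ S) = extend p (kernel S)

    kernel-isKernel : ∀ S → IsKernel Φ (S ++ P) (kernel S)
    kernel-isKernel []      = isK₀
    kernel-isKernel (p ∷ S) = extend-isKernel (kernel-isKernel S) p Φ-−

    kernel-trace : ∀ S → trace (S ++ P) (kernel S) ≈ trace P K₀
    kernel-trace []      = refl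
    kernel-trace (p ∷ S) = trans (extend-trace (kernel-isKernel S) p) (kernel-trace S)

    module _ (S : List I) where
      open IsKernel (kernel-isKernel S) public using ()
        renaming (diagonal-nonNegative to kernel-diagonal-nonNegative; 0<1+diagonal to 0<1+kernel-diagonal)

    kernel-↭ : ∀ {S S′} → S ↭ S′ → ∀ a b → kernel S a b ≈ kernel S′ a b
    kernel-↭ {S} {S′} S↭S′ =
      kernel-unique (kernel-isKernel S) (kernel-isKernel S′) (Σ-↭ (↭.++⁺ʳ P S↭S′))

    -- det (Σ_{i ∈ S ++ P} u_i u_iᵀ) / det (Σ_{i ∈ P} u_i u_iᵀ), by the matrix determinant lemma.
    volume : List I → Carrier
    volume []      = 1#
    volume (p ∷ S) = volume S * (1# + kernel S p p)

    volume-positive : ∀ S → 0# < volume S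
    volume-positive []      = 0<1
    volume-positive (p ∷ S) = *-positive (volume-positive S) (0<1+kernel-diagonal S p)

    private
      -- The 2 × 2 determinant of 1 + K on x and y. It is symmetric in x and y, so the volume does
      -- not depend on which of them is added first.
      [1+x][1+extend] : ∀ {T K} → IsKernel Φ T K → ∀ x y →
        (1# + K x x) * (1# + extend x K y y) ≈ (1# + K x x) * (1# + K y y) - K y x * K x y
      [1+x][1+extend] {K = K} isK x y = begin-equality
        α * (1# + (K y y - K y x * α ⁻¹ * K x y))
          ≈⟨ solve 5 (λ α k a β b → α :* (:1 :+ (k :- a :* β :* b)) := α :* (:1 :+ k) :- (α :* β) :* (a :* b))
               refl α (K y y) (K y x) (α ⁻¹) (K x y) ⟩
        α * (1# + K y y) - (α * α ⁻¹) * (K y x * K x y)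
          ≈⟨ +-congˡ (-‿cong (trans (*-congʳ (⁻¹-inverseʳ (>⇒≉ (IsKernel.0<1+diagonal isK x)))) (*-identityˡ _))) ⟩
        α * (1# + K y y) - K y x * K x y ∎
        where α = 1# + K x x

    volume-↭ : ∀ {S S′} → S ↭ S′ → volume S ≈ volume S′
    volume-↭ ↭.refl         = refl
    volume-↭ (prep x p)     = *-cong (volume-↭ p) (+-congˡ (kernel-↭ p x x))
    volume-↭ {_ ∷ _ ∷ S} {_ ∷ _ ∷ S′} (swap x y p) = begin-equality
      volume S * (1# + K y y) * (1# + extend y K x x)    ≈⟨ *-assoc _ _ _ ⟩
      volume S * ((1# + K y y) * (1# + extend y K x x))
        ≈⟨ *-congˡ ([1+x][1+extend] (kernel-isKernel S) y x) ⟩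
      volume S * ((1# + K y y) * (1# + K x x) - K x y * K y x)
        ≈⟨ *-cong (volume-↭ p) (solve 4 (λ a b c d → (:1 :+ a) :* (:1 :+ b) :- c :* d := (:1 :+ b) :* (:1 :+ a) :- d :* c)
             refl _ _ _ _) ⟩
      volume S′ * ((1# + K x x) * (1# + K y y) - K y x * K x y)
        ≈⟨ *-congˡ ([1+x][1+extend] (kernel-isKernel S) x y) ⟨
      volume S′ * ((1# + K x x) * (1# + extend x K y y))
        ≈⟨ *-congˡ (*-cong (+-congˡ (kernel-↭ p x x)) (+-congˡ (kernel-↭ (prep x p) y y))) ⟩
      volume S′ * ((1# + K′ x x) * (1# + extend x K′ y y))  ≈⟨ *-assoc _ _ _ ⟨
      volume S′ * (1# + K′ x x) * (1# + extend x K′ y y) ∎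
      where
      K  = kernel S
      K′ = kernel S′
    volume-↭ (↭.trans p q) = trans (volume-↭ p) (volume-↭ q)

    -- By optimality under exchanging i for j.
    maximal⇒diagonal-≤ : ∀ S j → (∀ S′ → length S′ ≡ length S → volume S′ ≤ volume S) → ∀ {i} → i ∈ S →
      kernel S j j * (1# - kernel S i i) ≤ kernel S i i
    maximal⇒diagonal-≤ S j S-max {i} i∈S with ∈-∃++ i∈S
    ... | xs , ys , ≡.refl = begin
      kernel S j j * (1# - kernel S i i)              ≈⟨ *-cong (S≈ j j) (+-congˡ (-‿cong (S≈ i i))) ⟩
      extend i κ j j * (1# - extend i κ i i)          ≈⟨ *-congˡ (1-extend-pivot κ-isKernel i) ⟩
      extend i κ j j * (1# + κ i i) ⁻¹
        ≤⟨ *-monoʳ-≤ (⁻¹-nonNegative (0<1+kernel-diagonal S⁻ i))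
                                                          (≤-trans (extend-diagonal-≤ κ-isKernel i j) κj≤κi) ⟩
      κ i i * (1# + κ i i) ⁻¹                         ≈⟨ *-comm _ _ ⟩
      (1# + κ i i) ⁻¹ * κ i i                         ≈⟨ extend-pivot κ-isKernel i i ⟨
      extend i κ i i                                  ≈⟨ S≈ i i ⟨
      kernel S i i                                    ∎
      where
      S⁻ = xs ++ ys
      κ  = kernel S⁻
      κ-isKernel = kernel-isKernel S⁻
      S↭ : S ↭ i ∷ S⁻
      S↭ = ↭.shift i xs ys
      S≈ : ∀ a b → kernel S a b ≈ extend i κ a b
      S≈ = kernel-↭ S↭
      κj≤κi : κ j j ≤ κ i i
      -- Adding i or j to S⁻ multiplies the positive `volume S⁻` by 1 + κ i i or 1 + κ j j, and S
      -- has the larger product.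
      κj≤κi = *-cancelˡ-≤ (volume-positive S⁻) (+-cancelʳ-≤ (volume S⁻) (begin
        volume S⁻ * κ j j + volume S⁻  ≈⟨ solve 2 (λ v k → v :* k :+ v := v :* (:1 :+ k)) refl _ _ ⟩
        volume (j ∷ S⁻)                ≤⟨ S-max (j ∷ S⁻) (≡.sym (↭.↭-length S↭)) ⟩
        volume S                       ≈⟨ volume-↭ S↭ ⟩
        volume (i ∷ S⁻)                ≈⟨ solve 2 (λ v k → v :* k :+ v := v :* (:1 :+ k)) refl _ _ ⟨
        volume S⁻ * κ i i + volume S⁻  ∎))

    -- Let ℓ be the score of j and τ ≤ k the sum of the scores over S. Summing the exchange
    -- inequality over the 2k members gives 2kℓ - ℓτ ≤ τ, hence kℓ ≤ k. Taking 2k members leaves a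
    -- factor of at least k after τ is subtracted.
    maximal⇒diagonal≤1 : ∀ {k} → 1 ℕ.≤ k → trace P K₀ ≤ fromℕ k → ∀ S → length S ≡ k ℕ.+ k →
      (∀ S′ → length S′ ≡ length S → volume S′ ≤ volume S) → ∀ j → kernel S j j ≤ 1#
    maximal⇒diagonal≤1 {k} 1≤k trace≤k S ∣S∣≡2k S-max j = *-cancelˡ-≤ (fromℕ-positive 1≤k) (begin
      fromℕ k * ℓ
        ≈⟨ solve 2 (λ k l → k :* l := (k :+ k) :* l :- l :* k) refl _ _ ⟩
      (fromℕ k + fromℕ k) * ℓ - ℓ * fromℕ k
        ≤⟨ +-monoʳ-≤ _ (-‿anti-≤ (*-monoˡ-≤ (kernel-diagonal-nonNegative S j) τ≤k)) ⟩
      (fromℕ k + fromℕ k) * ℓ - ℓ * τ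
        ≈⟨ +-congʳ (*-congʳ (trans (sym (fromℕ-+ k k)) (reflexive (≡.cong fromℕ (≡.sym ∣S∣≡2k))))) ⟩
      fromℕ (length S) * ℓ - ℓ * τ          ≈⟨ +-cong (Σ-const S ℓ) (-‿cong (Σ-*ˡ S ℓ _)) ⟨
      Σ S (λ _ → ℓ) - Σ S (λ i → ℓ * K i i)  ≈⟨ Σ-- S _ _ ⟨
      Σ S (λ i → ℓ - ℓ * K i i)
        ≈⟨ Σ-cong S (λ i → solve 2 (λ l k → l :- l :* k := l :* (:1 :- k)) refl _ _) ⟩
      Σ S (λ i → ℓ * (1# - K i i))          ≤⟨ Σ-mono-∈ S (maximal⇒diagonal-≤ S j S-max) ⟩
      τ                                     ≤⟨ τ≤k ⟩
      fromℕ k                               ≈⟨ *-identityʳ _ ⟨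
      fromℕ k * 1#                          ∎)
      where
      K = kernel S
      ℓ = K j j
      τ = trace S K
      τ≤k : τ ≤ fromℕ k
      τ≤k = begin
        τ                            ≤⟨ x≤x+y (Σ-nonNegative P (kernel-diagonal-nonNegative S)) ⟩
        trace S K + trace P K        ≈⟨ Σ-++ S P _ ⟨
        trace (S ++ P) K             ≈⟨ kernel-trace S ⟩
        trace P K₀                   ≤⟨ trace≤k ⟩
        fromℕ k                      ∎

-- Enumeration of tuples.

tuples : {A : Set} → ℕ → List A → List (List A)
tuples zero    xs = [] ∷ []
tuples (suc n) xs = cartesianProductWith _∷_ xs (tuples n xs)

∈-tuples⁺ : ∀ {A : Set} {xs : List A} → (∀ x → x ∈ xs) → ∀ ys → ys ∈ tuples (length ys) xs
∈-tuples⁺ all []       = here ≡.refl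
∈-tuples⁺ all (y ∷ ys) = ∈-cartesianProductWith⁺ _∷_ (all y) (∈-tuples⁺ all ys)

length-tuples : ∀ {A : Set} n {xs : List A} {ys} → ys ∈ tuples n xs → length ys ≡ n
length-tuples zero    (here ≡.refl) = ≡.refl
length-tuples (suc n) {xs} ys∈ with ∈-cartesianProductWith⁻ _∷_ xs (tuples n xs) ys∈
... | _ , _ , _ , zs∈ , ≡.refl = ≡.cong suc (length-tuples n zs∈)

-- Bases by elimination, and well-conditioned spanning lists.

module SpanningSubsets (F : OrderedField) where
  open OrderedField F
  open OrderedFieldProperties F
  open ListSums F
  open ReproducingKernels F

  -- P indexes a basis of the columns of a matrix and K is the Gram kernel of the coordinate
  -- vectors of the columns in that basis.
  record Interpolation {r} (P : List (Fin r)) (K : Fin r → Fin r → Carrier) : Set where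
    field
      isKernel    : IsKernel (Reproduces P K) P K
      interpolate : ∀ (f : Fin r → Carrier) {p} → p ∈ P → Σ P (λ i → f i * K i p) ≈ f p
      trace≈      : trace P K ≈ fromℕ (length P)

  module Pivot {r} {P : List (Fin r)} {K} (I : Interpolation P K)
               (φ : Fin r → Carrier) (q : Fin r) where
    open Interpolation I
    open IsKernel isKernel

    residual : Fin r → Carrier
    residual j = φ j - Σ P (λ i → φ i * K i j)

    -- The coordinate function dual to the new pivot q: it vanishes on P and, where the residual at
    -- q is nonzero, takes the value 1 at q.
    ψ : Fin r → Carrier
    ψ j = residual q ⁻¹ * residual j

    -- The expansion of Σ_{p ∈ P} (K p a - K p q ψ a)(K p b - K p q ψ b) + ψ a ψ b. In the enlarged
    -- basis, column j has coordinate ψ j at q and K p j - K p q ψ j at p ∈ P.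
    K′ : Fin r → Fin r → Carrier
    K′ a b = K a b - K a q * ψ b - ψ a * (K q b - (K q q + 1#) * ψ b)

    ψ-vanishes : ∀ {p} → p ∈ P → ψ p ≈ 0#
    ψ-vanishes {p} p∈P = begin-equality
      residual q ⁻¹ * residual p  ≈⟨ *-congˡ (+-congˡ (-‿cong (interpolate φ p∈P))) ⟩
      residual q ⁻¹ * (φ p - φ p) ≈⟨ solve 2 (λ x y → x :* (y :- y) := con 0ℤ) refl _ _ ⟩
      0#                          ∎

    K′-basis : ∀ {p} → p ∈ P → ∀ j → K′ p j ≈ K p j - K p q * ψ j
    K′-basis {p} p∈P j = begin-equality
      K′ p j                          ≈⟨ +-congˡ (-‿cong (*-congʳ (ψ-vanishes p∈P))) ⟩
      K p j - K p q * ψ j - 0# * _    ≈⟨ solve 2 (λ x y → x :- con 0ℤ :* y := x) refl _ _ ⟩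
      K p j - K p q * ψ j             ∎

    Σ-K′ : ∀ (f : Fin r → Carrier) j → Σ P (λ i → f i * K′ i j) ≈ Σ P (λ i → f i * K i j) - Σ P (λ i → f i * K i q) * ψ j
    Σ-K′ f j = begin-equality
      Σ P (λ i → f i * K′ i j)
        ≈⟨ Σ-cong-∈ P (λ i∈P → *-congˡ (K′-basis i∈P j)) ⟩
      Σ P (λ i → f i * (K i j - K i q * ψ j))
        ≈⟨ Σ-cong P (λ i → solve 4 (λ f x y z → f :* (x :- y :* z) := f :* x :- f :* y :* z) refl _ _ _ _) ⟩
      Σ P (λ i → f i * K i j - f i * K i q * ψ j)
        ≈⟨ trans (Σ-- P _ _) (+-congˡ (-‿cong (Σ-*ʳ P _ _))) ⟩
      Σ P (λ i → f i * K i j) - Σ P (λ i → f i * K i q) * ψ j ∎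

    K′-sym : ∀ a b → K′ a b ≈ K′ b a
    K′-sym a b = trans
      (+-cong (+-cong (K-sym a b) (-‿cong (*-congʳ (K-sym a q)))) (-‿cong (*-congˡ (+-congʳ (K-sym q b)))))
      (solve 6 (λ ba qa bq qq ya yb → ba :- qa :* yb :- ya :* (bq :- (qq :+ :1) :* yb) :=
                                      ba :- bq :* ya :- yb :* (qa :- (qq :+ :1) :* ya)) refl _ _ _ _ _ _)

    module _ (residual≉0 : ¬ residual q ≈ 0#) where

      ψq≈1 : ψ q ≈ 1#
      ψq≈1 = ⁻¹-inverseˡ residual≉0

      K′-pivot : ∀ j → K′ q j ≈ ψ j
      K′-pivot j = begin-equality
        K′ q j ≈⟨ +-congˡ (-‿cong (*-congʳ ψq≈1)) ⟩
        K q j - K q q * ψ j - 1# * (K q j - (K q q + 1#) * ψ j)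
          ≈⟨ solve 3 (λ x k y → x :- k :* y :- :1 :* (x :- (k :+ :1) :* y) := y) refl _ _ _ ⟩
        ψ j ∎

      -- The pivot term θ q · ψ j makes up for what the corrected coordinates on P lose.
      reproduces-preserved : ∀ {θ} → Reproduces P K θ → Reproduces (q ∷ P) K′ θ
      reproduces-preserved {θ} θ∈ j = sym (begin-equality
        θ q * K′ q j + Σ P (λ i → θ i * K′ i j)  ≈⟨ +-cong (*-congˡ (K′-pivot j)) (Σ-K′ θ j) ⟩
        θ q * ψ j + (Σ P (λ i → θ i * K i j) - Σ P (λ i → θ i * K i q) * ψ j)
          ≈⟨ +-congˡ (+-cong (θ∈ j) (-‿cong (*-congʳ (θ∈ q)))) ⟨
        θ q * ψ j + (θ j - θ q * ψ j)            ≈⟨ solve 2 (λ x y → x :+ (y :- x) := y) refl _ _ ⟩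
        θ j                                      ∎)

      reproduces-ψ : Reproduces (q ∷ P) K′ ψ
      reproduces-ψ j = sym (begin-equality
        ψ q * K′ q j + Σ P (λ i → ψ i * K′ i j)  ≈⟨ +-cong (*-cong ψq≈1 (K′-pivot j))
                                                      (Σ-cong-∈ P (λ i∈P → trans (*-congʳ (ψ-vanishes i∈P)) (zeroˡ _))) ⟩
        1# * ψ j + Σ P (λ _ → 0#)                ≈⟨ +-cong (*-identityˡ _) (Σ-zero P) ⟩
        ψ j + 0#                                 ≈⟨ +-identityʳ _ ⟩
        ψ j                                      ∎)

      -- The pivot contributes `residual q * ψ j`, which is the residual of φ at j.
      reproduces-φ : Reproduces (q ∷ P) K′ φ
      reproduces-φ j = sym (begin-equality
        φ q * K′ q j + Σ P (λ i → φ i * K′ i j)  ≈⟨ +-cong (*-congˡ (K′-pivot j)) (Σ-K′ φ j) ⟩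
        φ q * ψ j + (s j - s q * ψ j)
          ≈⟨ solve 4 (λ x y a b → x :* y :+ (a :- b :* y) := a :+ (x :- b) :* y) refl _ _ _ _ ⟩
        s j + residual q * (residual q ⁻¹ * residual j)  ≈⟨ +-congˡ (trans (sym (*-assoc _ _ _))
                                                              (trans (*-congʳ (⁻¹-inverseʳ residual≉0)) (*-identityˡ _))) ⟩
        s j + (φ j - s j)                        ≈⟨ solve 2 (λ x y → x :+ (y :- x) := y) refl _ _ ⟩
        φ j                                      ∎)
        where
        s : Fin r → Carrier
        s j = Σ P (λ i → φ i * K i j)

      extended : Interpolation (q ∷ P) K′
      extended = record
        { isKernel = record
          { K-sym      = K′-sym
          -- As a function of its second argument, `K′ a` is a combination of `K a`, `K q` and ψ,
          -- bracketed as in its definition.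
          ; member     = λ a → reproduces-− {T = q ∷ P} (reproduces-− {T = q ∷ P} (reproduces-preserved (member a)) reproduces-ψ (K a q))
                           (reproduces-− {T = q ∷ P} (reproduces-preserved (member q)) reproduces-ψ (K q q + 1#)) (ψ a)
          ; reproduces = λ θ∈ → θ∈
          }
        ; interpolate = interpolate′
        ; trace≈ = begin-equality
            K′ q q + Σ P (λ i → K′ i i)
              ≈⟨ +-cong (trans (K′-pivot q) ψq≈1) (Σ-cong-∈ P (λ i∈P → trans (K′-basis i∈P _)
                   (+-congˡ (-‿cong (*-congˡ (ψ-vanishes i∈P)))))) ⟩
            1# + Σ P (λ i → K i i - K i q * 0#)
              ≈⟨ +-congˡ (Σ-cong P (λ i → solve 2 (λ x y → x :- y :* con 0ℤ := x) refl _ _)) ⟩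
            1# + trace P K
              ≈⟨ +-congˡ trace≈ ⟩
            fromℕ (suc (length P)) ∎
        }
        where
        interpolate′ : ∀ (f : Fin r → Carrier) {p} → p ∈ q ∷ P → Σ (q ∷ P) (λ i → f i * K′ i p) ≈ f p
        interpolate′ f (here ≡.refl) = begin-equality
          f q * K′ q q + Σ P (λ i → f i * K′ i q)
            ≈⟨ +-cong (*-congˡ (trans (K′-pivot q) ψq≈1)) (trans (Σ-K′ f q) (+-congˡ (-‿cong (*-congˡ ψq≈1)))) ⟩
          f q * 1# + (Σ P (λ i → f i * K i q) - Σ P (λ i → f i * K i q) * 1#)
            ≈⟨ solve 2 (λ x y → x :* :1 :+ (y :- y :* :1) := x) refl _ _ ⟩
          f q ∎
        interpolate′ f {p} (there p∈P) = begin-equality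
          f q * K′ q p + Σ P (λ i → f i * K′ i p)
            ≈⟨ +-cong (*-congˡ (trans (K′-pivot p) (ψ-vanishes p∈P)))
                                                       (trans (Σ-K′ f p) (+-cong (interpolate f p∈P) (-‿cong (*-congˡ (ψ-vanishes p∈P))))) ⟩
          f q * 0# + (f p - Σ P (λ i → f i * K i q) * 0#)
            ≈⟨ solve 3 (λ x y z → x :* con 0ℤ :+ (y :- z :* con 0ℤ) := y) refl _ _ _ ⟩
          f p ∎

  -- Gaussian elimination. A function that is already reproduced adds nothing; any other one fails
  -- at some index q, which decidable equality finds and which becomes a pivot.
  basis : ∀ {r} k (u : Fin k → Fin r → Carrier) →
          Σ[ P ∈ List (Fin r) ] Σ[ K ∈ (Fin r → Fin r → Carrier) ]
            length P ℕ.≤ k × Interpolation P K × (∀ l → Reproduces P K (u l))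
  basis zero u = [] , (λ _ _ → 0#) , ℕ.z≤n , record
    { isKernel    = record { K-sym = λ _ _ → refl ; member = λ _ _ → refl ; reproduces = λ φ∈ → φ∈ }
    ; interpolate = λ _ ()
    ; trace≈      = refl
    } , λ ()
  basis {r} (suc k) u with basis k (λ l → u (suc l))
  ... | P , K , ∣P∣≤k , I , u∈ with Fin.all? (λ j → u zero j ≟ Σ P (λ i → u zero i * K i j))
  ... | yes u₀∈ = P , K , ℕ.m≤n⇒m≤1+n ∣P∣≤k , I , λ { zero → u₀∈ ; (suc l) → u∈ l }
  ... | no  u₀∉ = q ∷ P , K′ , ℕ.s≤s ∣P∣≤k , extended r≉0 ,
    λ { zero → reproduces-φ r≉0 ; (suc l) → reproduces-preserved r≉0 (u∈ l) }
    where
    q≉ = Fin.¬∀⟶∃¬ r _ (λ j → u zero j ≟ Σ P (λ i → u zero i * K i j)) u₀∉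
    q = proj₁ q≉
    open Pivot I (u zero) q
    r≉0 : ¬ residual q ≈ 0#
    r≉0 r≈0 = proj₂ q≉ (begin-equality
      u zero q                      ≈⟨ solve 2 (λ x y → x := x :- y :+ y) refl _ _ ⟩
      residual q + _                ≈⟨ trans (+-congʳ r≈0) (+-identityˡ _) ⟩
      Σ P (λ i → u zero i * K i q)  ∎)

  -- There are finitely many 2k-tuples, so one of greatest volume exists; at most k basis indices
  -- are appended to it. The sum of squared coefficients is a diagonal entry of its kernel.
  wellConditionedSpanningList :
    ∀ {k k′ r} → 1 ℕ.≤ k → k′ ℕ.≤ k → (u : Fin k′ → Fin r → Carrier) →
    Σ[ T ∈ List (Fin r) ] Σ[ K ∈ (Fin r → Fin r → Carrier) ]
      length T ℕ.≤ 3 ℕ.* k × (∀ l → Reproduces T K (u l)) × (∀ j → Σ T (λ i → K i j * K i j) ≤ 1#)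
  -- With no index at all, the default tuple below could not be formed.
  wellConditionedSpanningList {r = zero} _ _ u = [] , (λ ()) , ℕ.z≤n , (λ _ ()) , (λ ())
  wellConditionedSpanningList {k} {k′} {suc r} 1≤k k′≤k u with basis k′ u
  ... | P , K₀ , ∣P∣≤k′ , I , u∈ =
    S ++ P , kernel S , ∣S++P∣≤3k , (λ l → IsKernel.reproduces (kernel-isKernel S) (u∈ l)) ,
    λ j → ≤-respˡ-≈ (sym (IsKernel.squares (kernel-isKernel S) j))
            (maximal⇒diagonal≤1 1≤k trace≤k S ∣S∣≡2k S-max j)
    where
    open Interpolation I
    open Volume (Reproduces P K₀) (reproduces-− {T = P}) P K₀ isKernel
    open Extrema (DecTotalOrder.totalOrder decTotalOrder)
    candidates = tuples (k ℕ.+ k) (allFin (suc r))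
    -- `argmax` needs a starting value; one of length 2k guarantees that the result has length 2k.
    default = replicate (k ℕ.+ k) zero
    S = argmax volume default candidates
    ∣S∣≡2k : length S ≡ k ℕ.+ k
    ∣S∣≡2k = argmax-all volume {P = λ S → length S ≡ k ℕ.+ k} (List.length-replicate (k ℕ.+ k))
               (All.tabulate (length-tuples (k ℕ.+ k)))
    S-max : ∀ S′ → length S′ ≡ length S → volume S′ ≤ volume S
    S-max S′ ∣S′∣≡∣S∣ = All.lookup (f[xs]≤f[argmax] {f = volume} default candidates)
      (≡.subst (λ n → S′ ∈ tuples n (allFin (suc r))) (≡.trans ∣S′∣≡∣S∣ ∣S∣≡2k) (∈-tuples⁺ ∈-allFin S′))
    trace≤k : trace P K₀ ≤ fromℕ k
    trace≤k = ≤-respˡ-≈ (sym trace≈) (fromℕ-mono-≤ (ℕ.≤-trans ∣P∣≤k′ k′≤k))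
    ∣S++P∣≤3k : length (S ++ P) ℕ.≤ 3 ℕ.* k
    ∣S++P∣≤3k = ℕ.≤-trans (ℕ.≤-reflexive (List.length-++ S))
      (ℕ.≤-trans (ℕ.+-mono-≤ (ℕ.≤-reflexive ∣S∣≡2k) (ℕ.≤-trans ∣P∣≤k′ k′≤k))
        (ℕ.≤-reflexive (2k+k≡3k k)))
      where
      2k+k≡3k : ∀ k → k ℕ.+ k ℕ.+ k ≡ 3 ℕ.* k
      2k+k≡3k = solve-∀

-- Consequences of the approximate triangle inequality and of linear growth.

module LossBounds (F : OrderedField) (g : Matrices.Loss F) (ati lin : OrderedField.Carrier F) where
  open OrderedField F
  open OrderedFieldProperties F
  open ListSums F
  open Matrices F
  open Loss g renaming (cong to fun-cong; nonNegative to fun-nonNegative)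

  Σ-replicate : ∀ n e (f : Carrier → Carrier) → Σ (replicate n e) f ≈ fromℕ n * f e
  Σ-replicate zero    e f = sym (zeroˡ _)
  Σ-replicate (suc n) e f = begin-equality
    f e + Σ (replicate n e) f   ≈⟨ +-congˡ (Σ-replicate n e f) ⟩
    f e + fromℕ n * f e         ≈⟨ solve 2 (λ x y → x :+ y :* x := (:1 :+ y) :* x) refl _ _ ⟩
    fromℕ (suc n) * f e         ∎

  triangle-list : ∀ {t} → ApproxTriangle g t ati →
                  ∀ xs → length xs ≡ t → fun (Σ xs id) ≤ ati * Σ xs fun
  triangle-list triangle xs ≡.refl = begin
    fun (Σ xs id)                              ≈⟨ fun-cong (sum≈ id) ⟨
    fun (sum (lookup xs))                      ≤⟨ triangle (lookup xs) ⟩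
    ati * sum (λ i → fun (lookup xs i))        ≈⟨ *-congˡ (sum≈ fun) ⟩
    ati * Σ xs fun                             ∎
    where
    sum≈ : ∀ f → sum (λ i → f (lookup xs i)) ≈ Σ xs f
    sum≈ f = trans (sum≈Σ-tabulate (lookup xs) f)
                   (reflexive (≡.cong (λ ys → Σ ys f) (List.tabulate-lookup xs)))

  module Growth (0<lin : 0# < lin) (growth : LinearGrowth g lin) where

    -- Linear growth applied to the pair c x and x, with both quotients cleared.
    shrink-nonzero : ∀ {c x} → ∣ c ∣ ≤ 1# → ¬ c * x ≈ 0# → lin * fun (c * x) ≤ ∣ c ∣ * fun x
    shrink-nonzero {c} {x} ∣c∣≤1 cx≉0 with fun (c * x) ≟ 0#
    -- The growth condition says nothing where g(c x) = 0, but there the left side vanishes.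
    ... | yes G≈0 = begin
      lin * fun (c * x)  ≈⟨ trans (*-congˡ G≈0) (zeroʳ lin) ⟩
      0#                 ≤⟨ *-nonNegative (∣x∣-nonNegative c) (fun-nonNegative x) ⟩
      ∣ c ∣ * fun x      ∎
    ... | no G≉0 = *-cancelˡ-≤ 0<∣x∣ (begin
      ∣ x ∣ * (lin * G)
        ≈⟨ solve 3 (λ x l G → x :* (l :* G) := (l :* (x :* :1)) :* (G :* :1)) refl _ _ _ ⟩
      lin * (∣ x ∣ * 1#) * (G * 1#)
        ≈⟨ *-congʳ (*-congˡ (*-congˡ (⁻¹-inverseˡ (>⇒≉ 0<a)))) ⟨
      lin * (∣ x ∣ * (a ⁻¹ * a)) * (G * 1#)
        ≈⟨ solve 5 (λ l x b a G → (l :* (x :* (b :* a))) :* (G :* :1) := (l :* (x :* b)) :* (a :* G)) refl _ _ _ _ _ ⟩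
      lin * (∣ x ∣ / a) * (a * G)
        ≤⟨ *-monoʳ-≤ (*-nonNegative (∣x∣-nonNegative _) (fun-nonNegative _)) (growth (c * x) x 0<a a≤∣x∣ G≉0) ⟩
      fun x / G * (a * G)
        ≈⟨ solve 4 (λ f b a G → f :* b :* (a :* G) := (b :* G) :* (f :* a)) refl _ _ _ _ ⟩
      G ⁻¹ * G * (fun x * a)
        ≈⟨ trans (*-cong (⁻¹-inverseˡ G≉0) (*-congˡ (∣xy∣≈∣x∣∣y∣ c x))) (*-identityˡ _) ⟩
      fun x * (∣ c ∣ * ∣ x ∣)
        ≈⟨ solve 3 (λ f c x → f :* (c :* x) := x :* (c :* f)) refl _ _ _ ⟩
      ∣ x ∣ * (∣ c ∣ * fun x) ∎)
      where
      a = ∣ c * x ∣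
      G = fun (c * x)
      0<a : 0# < a
      0<a = x≉0⇒0<∣x∣ cx≉0
      0<∣x∣ : 0# < ∣ x ∣
      0<∣x∣ = x≉0⇒0<∣x∣ (λ x≈0 → cx≉0 (trans (*-congˡ x≈0) (zeroʳ c)))
      a≤∣x∣ : a ≤ ∣ x ∣
      a≤∣x∣ = begin
        ∣ c * x ∣      ≈⟨ ∣xy∣≈∣x∣∣y∣ c x ⟩
        ∣ c ∣ * ∣ x ∣  ≤⟨ *-monoʳ-≤ (∣x∣-nonNegative x) ∣c∣≤1 ⟩
        1# * ∣ x ∣     ≈⟨ *-identityˡ _ ⟩
        ∣ x ∣          ∎

    module _ {n} (1≤n : 1 ℕ.≤ n) (triangle : ApproxTriangle g (suc n) ati) where

      private
        N = fromℕ n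
        D = lin * fun 0#

      -- From 0 = −n e + e + … + e.
      zero-split : 0# ≤ ati → ∀ e → 0# < e → N * e ≤ 1# → D ≤ ati * ((N + N) * fun 1#) * e
      zero-split 0≤ati e 0<e Ne≤1 = begin
        lin * fun 0#
          ≈⟨ *-congˡ (fun-cong (trans (+-congˡ (Σ-replicate n e id)) (solve 2 (λ n e → (:- (n :* e)) :* :1 :+ n :* e := con 0ℤ) refl N e))) ⟨
        lin * fun (Σ xs id)
          ≤⟨ *-monoˡ-≤ (proj₁ 0<lin) (triangle-list triangle xs (≡.cong suc (List.length-replicate n))) ⟩
        lin * (ati * Σ xs fun)
          ≈⟨ *-congˡ (*-congˡ (+-congˡ (Σ-replicate n e fun))) ⟩
        lin * (ati * (fun (- (N * e) * 1#) + N * fun e))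
          ≈⟨ solve 5 (λ l a x n y → l :* (a :* (x :+ n :* y)) := a :* (l :* x :+ n :* (l :* y))) refl _ _ _ _ _ ⟩
        ati * (lin * fun (- (N * e) * 1#) + N * (lin * fun e))
          ≤⟨ *-monoˡ-≤ 0≤ati (+-mono-≤ first (*-monoˡ-≤ (fromℕ-nonNegative n) rest)) ⟩
        ati * (N * e * fun 1# + N * (e * fun 1#))
          ≈⟨ solve 4 (λ a n e f → a :* (n :* e :* f :+ n :* (e :* f)) := a :* ((n :+ n) :* f) :* e) refl _ _ _ _ ⟩
        ati * ((N + N) * fun 1#) * e ∎
        where
        -- The first term is written as a multiple of `1#` so that its loss can be compared with
        -- that of `1#`.
        xs = - (N * e) * 1# ∷ replicate n e
        0<Ne : 0# < N * e
        0<Ne = *-positive (fromℕ-positive 1≤n) 0<e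
        ∣-Ne∣ : ∣ - (N * e) ∣ ≈ N * e
        ∣-Ne∣ = trans (∣-x∣≈∣x∣ _) (0≤x⇒∣x∣≈x (proj₁ 0<Ne))
        first : lin * fun (- (N * e) * 1#) ≤ N * e * fun 1#
        first = ≤-respʳ-≈ (*-congʳ ∣-Ne∣) (shrink-nonzero (≤-respˡ-≈ (sym ∣-Ne∣) Ne≤1)
          (λ p → >⇒≉ 0<Ne (trans (solve 1 (λ x → x := :- ((:- x) :* :1)) refl _)
            (trans (-‿cong p) (solve 0 (:- con 0ℤ := con 0ℤ) refl)))))
        e≤1 : e ≤ 1#
        e≤1 = begin
          e            ≈⟨ solve 1 (λ e → e := (:1 :+ con 0ℤ) :* e) refl e ⟩
          fromℕ 1 * e  ≤⟨ *-monoʳ-≤ (proj₁ 0<e) (fromℕ-mono-≤ 1≤n) ⟩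
          N * e        ≤⟨ Ne≤1 ⟩
          1#           ∎
        rest : lin * fun e ≤ e * fun 1#
        rest = begin
          lin * fun e         ≈⟨ *-congˡ (fun-cong (*-identityʳ e)) ⟨
          lin * fun (e * 1#)
            ≤⟨ shrink-nonzero (≤-respˡ-≈ (sym ∣e∣≈e) e≤1) (λ p → >⇒≉ 0<e (trans (sym (*-identityʳ e)) p)) ⟩
          ∣ e ∣ * fun 1#      ≈⟨ *-congʳ ∣e∣≈e ⟩
          e * fun 1#          ∎
          where
          ∣e∣≈e : ∣ e ∣ ≈ e
          ∣e∣≈e = 0≤x⇒∣x∣≈x (proj₁ 0<e)

      -- Growth does not constrain g at 0 directly. If g(0) were positive, `zero-split` would bound
      -- the fixed number lin · g(0) by a constant times e for arbitrarily small e.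
      fun-zero : 0# ≤ ati → fun 0# ≈ 0#
      fun-zero 0≤ati with fun 0# ≤? 0#
      ... | yes G≤0 = ≤-antisym G≤0 (fun-nonNegative 0#)
      ... | no  G≰0 = ⊥-elim (<⇒≱ (*-positive 0<D 0<e) (+-cancelʳ-≤ (C * e) (begin
        D * e + C * e
          ≤⟨ x≤x+y (*-nonNegative (fromℕ-nonNegative n) (*-nonNegative (proj₁ 0<D) (proj₁ 0<e))) ⟩
        D * e + C * e + N * (D * e)
          ≈⟨ solve 4 (λ d c n e → d :* e :+ c :* e :+ n :* (d :* e) := (c :+ n :* d :+ d) :* e) refl _ _ _ _ ⟩
        W * e                      ≈⟨ We≈D ⟩
        D                          ≤⟨ zero-split 0≤ati e 0<e Ne≤1 ⟩
        C * e                      ≈⟨ +-identityˡ _ ⟨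
        0# + C * e                 ∎)))
        where
        C = ati * ((N + N) * fun 1#)
        W = C + N * D + D
        -- Then C e + N D e + D e = D. The middle term gives N e ≤ 1, and the last one gives C e <
        -- D, which contradicts `zero-split`.
        e = D * W ⁻¹
        0≤N = fromℕ-nonNegative n
        0<D : 0# < D
        0<D = *-positive 0<lin (≰⇒> G≰0)
        0≤C : 0# ≤ C
        0≤C = *-nonNegative 0≤ati (*-nonNegative (+-nonNegative 0≤N 0≤N) (fun-nonNegative 1#))
        0<W : 0# < W
        0<W = <-≤-trans 0<D (x≤y+x (+-nonNegative 0≤C (*-nonNegative 0≤N (proj₁ 0<D))))
        We≈D : W * e ≈ D
        We≈D = trans (solve 3 (λ w d v → w :* (d :* v) := (w :* v) :* d) refl _ _ _)
                 (trans (*-congʳ (⁻¹-inverseʳ (>⇒≉ 0<W))) (*-identityˡ D))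
        0<e : 0# < e
        0<e = *-nonNegative (proj₁ 0<D) (⁻¹-nonNegative 0<W) , λ 0≈e → >⇒≉ 0<D (trans (sym We≈D) (trans (*-congˡ (sym 0≈e)) (zeroʳ W)))
        Ne≤1 : N * e ≤ 1#
        Ne≤1 = *-cancelˡ-≤ 0<D (begin
          D * (N * e)
            ≤⟨ x≤y+x (*-nonNegative (+-nonNegative 0≤C (proj₁ 0<D)) (proj₁ 0<e)) ⟩
          (C + D) * e + D * (N * e)
            ≈⟨ solve 4 (λ d c n e → (c :+ d) :* e :+ d :* (n :* e) := (c :+ n :* d :+ d) :* e) refl _ _ _ _ ⟩
          W * e                      ≈⟨ We≈D ⟩
          D                          ≈⟨ *-identityʳ D ⟨
          D * 1#                     ∎)

    module _ (fun0≈0 : fun 0# ≈ 0#) where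

      -- At c x = 0, where growth is silent, g(0) = 0 takes over.
      shrink : ∀ {c} x → ∣ c ∣ ≤ 1# → lin * fun (c * x) ≤ ∣ c ∣ * fun x
      shrink {c} x ∣c∣≤1 with c * x ≟ 0#
      ... | no  cx≉0 = shrink-nonzero ∣c∣≤1 cx≉0
      ... | yes cx≈0 = begin
        lin * fun (c * x)  ≈⟨ trans (*-congˡ (trans (fun-cong cx≈0) fun0≈0)) (zeroʳ lin) ⟩
        0#                 ≤⟨ *-nonNegative (∣x∣-nonNegative c) (fun-nonNegative x) ⟩
        ∣ c ∣ * fun x      ∎

      -- The case c = 1 of `shrink`. It lets a summand with coefficient 1 absorb the factor lin like
      -- the others.
      lin*fun≤fun : ∀ x → lin * fun x ≤ fun x
      lin*fun≤fun x = begin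
        lin * fun x         ≈⟨ *-congˡ (fun-cong (*-identityˡ x)) ⟨
        lin * fun (1# * x)  ≤⟨ shrink x (≤-reflexive ∣1∣≈1) ⟩
        ∣ 1# ∣ * fun x      ≈⟨ trans (*-congʳ ∣1∣≈1) (*-identityˡ _) ⟩
        fun x               ∎
        where
        ∣1∣≈1 : ∣ 1# ∣ ≈ 1#
        ∣1∣≈1 = 0≤x⇒∣x∣≈x 0≤1

      -- Short lists are padded with zeros, which cost nothing because g(0) = 0.
      triangle-list-≤ : ∀ {t} → ApproxTriangle g t ati →
                        ∀ xs → length xs ℕ.≤ t → fun (Σ xs id) ≤ ati * Σ xs fun
      triangle-list-≤ {t} triangle xs ∣xs∣≤t = begin
        fun (Σ xs id)     ≈⟨ fun-cong (padded id refl) ⟨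
        fun (Σ ys id)     ≤⟨ triangle-list triangle ys
                               (≡.trans (List.length-++ xs) (≡.trans (≡.cong (length xs ℕ.+_) (List.length-replicate m)) (ℕ.m+[n∸m]≡n ∣xs∣≤t))) ⟩
        ati * Σ ys fun    ≈⟨ *-congˡ (padded fun fun0≈0) ⟩
        ati * Σ xs fun    ∎
        where
        m = t ℕ.∸ length xs
        ys = xs ++ replicate m 0#
        padded : ∀ f → f 0# ≈ 0# → Σ ys f ≈ Σ xs f
        padded f f0≈0 = begin-equality
          Σ ys f                              ≈⟨ Σ-++ xs _ f ⟩
          Σ xs f + Σ (replicate m 0#) f
            ≈⟨ +-congˡ (trans (Σ-replicate m 0# f) (trans (*-congˡ f0≈0) (zeroʳ _))) ⟩
          Σ xs f + 0#                         ≈⟨ +-identityʳ _ ⟩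
          Σ xs f                              ∎

      combination-bound : ∀ {t} → ApproxTriangle g (suc t) ati → 0# ≤ ati →
        ∀ {I : Set} (T : List I) → length T ℕ.≤ t → ∀ z (c x : I → Carrier) → (∀ {i} → i ∈ T → ∣ c i ∣ ≤ 1#) →
        lin * fun (z + Σ T (λ i → c i * x i)) ≤ ati * (fun z + Σ T (λ i → ∣ c i ∣ * fun (x i)))
      combination-bound triangle 0≤ati T ∣T∣≤t z c x ∣c∣≤1 = begin
        lin * fun (z + Σ T (λ i → c i * x i))
          ≈⟨ *-congˡ (fun-cong (+-congˡ (Σ-map _ T id))) ⟨
        lin * fun (Σ (z ∷ map (λ i → c i * x i) T) id)
          ≤⟨ *-monoˡ-≤ (proj₁ 0<lin) (triangle-list-≤ triangle (z ∷ map (λ i → c i * x i) T)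
               (ℕ.s≤s (ℕ.≤-trans (ℕ.≤-reflexive (List.length-map _ T)) ∣T∣≤t))) ⟩
        lin * (ati * (fun z + Σ (map (λ i → c i * x i) T) fun))
          ≈⟨ *-congˡ (*-congˡ (+-congˡ (Σ-map _ T fun))) ⟩
        lin * (ati * (fun z + Σ T (λ i → fun (c i * x i))))
          ≈⟨ solve 4 (λ l a x y → l :* (a :* (x :+ y)) := a :* (l :* x :+ l :* y)) refl _ _ _ _ ⟩
        ati * (lin * fun z + lin * Σ T (λ i → fun (c i * x i)))
          ≈⟨ *-congˡ (+-congˡ (Σ-*ˡ T lin _)) ⟨
        ati * (lin * fun z + Σ T (λ i → lin * fun (c i * x i)))
          ≤⟨ *-monoˡ-≤ 0≤ati (+-mono-≤ (lin*fun≤fun z) (Σ-mono-∈ T (λ i∈T → shrink (x _) (∣c∣≤1 i∈T)))) ⟩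
        ati * (fun z + Σ T (λ i → ∣ c i ∣ * fun (x i))) ∎

-- Splitting a list into a lower and an upper half.

AllPairs-++⁻ : ∀ {A : Set} {R : A → A → Set} xs {ys} → AllPairs R (xs ++ ys) →
               ∀ {x y} → x ∈ xs → y ∈ ys → R x y
AllPairs-++⁻ (_ ∷ xs) (R ∷ _)  (here ≡.refl) y∈ys = All.lookup R (∈-++⁺ʳ xs y∈ys)
AllPairs-++⁻ (_ ∷ xs) (_ ∷ Rs) (there x∈xs)  y∈ys = AllPairs-++⁻ xs Rs x∈xs y∈ys

n≤2m⇒⌈n/2⌉≤m : ∀ {n m} → n ℕ.≤ 2 ℕ.* m → ℕ.⌈ n /2⌉ ℕ.≤ m
n≤2m⇒⌈n/2⌉≤m {n} {m} n≤2m = ℕ.≤-trans (ℕ.⌈n/2⌉-mono n≤2m)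
  (ℕ.≤-reflexive (≡.sym (≡.trans (ℕ.n≡⌈n+n/2⌉ m) (≡.cong (λ x → ℕ.⌈ m ℕ.+ x /2⌉) (≡.sym (ℕ.+-identityʳ m))))))

module Halving (O : DecTotalOrder 0ℓ 0ℓ 0ℓ) where
  open DecTotalOrder O
  open Sort O

  -- Since the upper half is sorted, its head is a threshold between the halves. The upper half gets
  -- the extra element of an odd list, so it is never the smaller one.
  halve : ∀ (xs : List Carrier) → Σ[ ls ∈ List Carrier ] Σ[ us ∈ List Carrier ]
          xs ↭ ls ++ us × length ls ≡ ℕ.⌊ length xs /2⌋ × length us ≡ ℕ.⌈ length xs /2⌉ ×
          (∀ {l u} → l ∈ ls → u ∈ us → l ≤ u) × AllPairs _≤_ us
  halve xs = take h ys , drop h ys ,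
    ≡.subst (xs ↭_) (≡.sym (List.take++drop≡id h ys)) (↭-sym (sort-↭ xs)) ,
    ≡.trans (List.length-take h ys) (≡.trans (≡.cong (h ℕ.⊓_) ∣ys∣≡n) (ℕ.m≤n⇒m⊓n≡m (ℕ.⌊n/2⌋≤n n))) ,
    ≡.trans (List.length-drop h ys) (≡.trans (≡.cong (ℕ._∸ h) ∣ys∣≡n) n∸h≡⌈n/2⌉) ,
    AllPairs-++⁻ (take h ys) (≡.subst (AllPairs _≤_) (≡.sym (List.take++drop≡id h ys)) sorted) ,
    AllPairs.drop⁺ h sorted
    where
    n = length xs
    h = ℕ.⌊ n /2⌋
    ys = sort xs
    sorted : AllPairs _≤_ ys
    sorted = Linked⇒AllPairs trans (sort-↗ xs)
    ∣ys∣≡n : length ys ≡ n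
    ∣ys∣≡n = ↭.↭-length (sort-↭ xs)
    n∸h≡⌈n/2⌉ : n ℕ.∸ h ≡ ℕ.⌈ n /2⌉
    n∸h≡⌈n/2⌉ = ≡.trans (≡.cong (ℕ._∸ h) (≡.trans (≡.sym (ℕ.⌊n/2⌋+⌈n/2⌉≡n n)) (ℕ.+-comm h _))) (ℕ.m+n∸n≡m _ h)

-- Products with a list of columns.

module Columns (F : OrderedField) where
  open OrderedField F
  open OrderedFieldProperties F
  open ListSums F
  open Matrices F

  columns : ∀ {n d} → Matrix n d → (T : List (Fin d)) → Matrix n (length T)
  columns A T i q = A i (lookup T q)

  module _ {n d} (A : Matrix n d) where

    -- Building the vector by recursion on T avoids transporting it along the equality of the
    -- lengths of `map h T` and T.
    columns-* : ∀ {I : Set} (h : I → Fin d) (T : List I) (c : I → Carrier) →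
                Σ[ x ∈ Vector Carrier (length (map h T)) ]
                  (∀ i → (columns A (map h T) *ᵥ x) i ≈ Σ T (λ t → A i (h t) * c t))
    columns-* h []      c = (λ ()) , λ _ → refl
    columns-* h (t ∷ T) c with columns-* h T c
    ... | x , x≈ = c t Vector.∷ x , λ i → +-congˡ (x≈ i)

    columns-++ˡ : ∀ T U (x : Vector Carrier (length T)) →
                  Σ[ y ∈ Vector Carrier (length (T ++ U)) ]
                    (∀ i → (columns A (T ++ U) *ᵥ y) i ≈ (columns A T *ᵥ x) i)
    columns-++ˡ []      U x = (λ _ → 0#) , λ i → trans (sum≈Σ (λ q → A i (lookup U q) * 0#))
      (trans (Σ-cong (allFin (length U)) (λ q → zeroʳ _)) (Σ-zero (allFin (length U))))
    columns-++ˡ (t ∷ T) U x with columns-++ˡ T U (x ∘ suc)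
    ... | y , y≈ = x zero Vector.∷ y , λ i → +-congˡ (y≈ i)

    columns-++ʳ : ∀ T U (x : Vector Carrier (length U)) →
                  Σ[ y ∈ Vector Carrier (length (T ++ U)) ]
                    (∀ i → (columns A (T ++ U) *ᵥ y) i ≈ (columns A U *ᵥ x) i)
    columns-++ʳ []      U x = x , λ _ → refl
    columns-++ʳ (t ∷ T) U x with columns-++ʳ T U x
    ... | y , y≈ = 0# Vector.∷ y , λ i → trans (+-congʳ (zeroʳ _)) (trans (+-identityˡ _) (y≈ i))

-- Infima, square roots and regression costs over the reals.

module RealProperties (F : OrderedField) (complete : Complete F) where
  open OrderedField F
  open OrderedFieldProperties F
  open ListSums F
  open Matrices F
  open Reals F complete
  open Columns F

  module _ {I : Set} (f : I → Carrier) (i₀ : I) (0≤f : ∀ i → 0# ≤ f i) where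

    private
      lub = complete (λ z → ∀ i → z ≤ f i) (0# , 0≤f) (f i₀ , λ z p → p i₀)

    inf-lower : ∀ i → inf f i₀ 0≤f ≤ f i
    inf-lower i = proj₂ (proj₂ lub) (f i) (λ z p → p i)

    inf-greatest : ∀ {z} → (∀ i → z ≤ f i) → z ≤ inf f i₀ 0≤f
    inf-greatest {z} = proj₁ (proj₂ lub) z

  -- The upper-bound half of the supremum that defines `√ℕ n`.
  x*x≤n⇒x≤√n : ∀ {x n} → x * x ≤ fromℕ n → x ≤ √ℕ n
  x*x≤n⇒x≤√n {x} {n} = proj₁ (proj₂ (complete (λ y → y * y ≤ fromℕ n)
    (0# , ≤-respˡ-≈ (sym (zeroˡ 0#)) (fromℕ-nonNegative n))
    (1# + fromℕ n , λ y → x≤1+y (fromℕ-nonNegative n)))) x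

  1≤√n : ∀ {n} → 1 ℕ.≤ n → 1# ≤ √ℕ n
  1≤√n {n} 1≤n = x*x≤n⇒x≤√n {n = n} (begin
    1# * 1#  ≈⟨ solve 0 (:1 :* :1 := :1 :+ con 0ℤ) refl ⟩
    fromℕ 1  ≤⟨ fromℕ-mono-≤ 1≤n ⟩
    fromℕ n  ∎)

  -- The regression cost of −a_j rather than a_j: solvers bound ‖Bx − b‖, while the theorem is
  -- about ‖a_j − A|^S x‖, and the loss need not be even.
  module Cost (g : Loss) {n d} (A : Matrix n d) where
    open Loss g using (fun) renaming (cong to fun-cong; nonNegative to fun-nonNegative)

    normᵥ≈Σ : ∀ {m} (v : Vector Carrier m) → normᵥ g v ≈ Σ (allFin m) (λ i → fun (v i))
    normᵥ≈Σ v = sum≈Σ (λ i → fun (v i))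

    normᵥ-cong : ∀ {m} {v w : Vector Carrier m} → (∀ i → v i ≈ w i) → normᵥ g v ≈ normᵥ g w
    normᵥ-cong {m} {v} {w} v≈w =
      trans (normᵥ≈Σ v) (trans (Σ-cong (allFin m) (λ i → fun-cong (v≈w i))) (sym (normᵥ≈Σ w)))

    target : Fin d → Vector Carrier n
    target j i = - A i j

    cost : List (Fin d) → Fin d → Carrier
    cost T j = minRegression g (columns A T) (target j)

    cost-≤ : ∀ T j x → cost T j ≤ normᵥ g (columns A T *ᵥ x -ᵥ target j)
    cost-≤ T j = inf-lower _ _ (λ x → normᵥ-nonNegative g (columns A T *ᵥ x -ᵥ target j))

    cost-nonNegative : ∀ T j → 0# ≤ cost T j
    cost-nonNegative T j = inf-greatest _ _ _ (λ x → normᵥ-nonNegative g (columns A T *ᵥ x -ᵥ target j))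

    -- Every product with the columns of T is a product with those of U, so the infimum for U ranges
    -- over at least as many values.
    cost-mono : ∀ T U j → (∀ x → Σ[ y ∈ Vector Carrier (length U) ] (∀ i → (columns A U *ᵥ y) i ≈ (columns A T *ᵥ x) i)) →
                cost U j ≤ cost T j
    cost-mono T U j T⊆U = inf-greatest _ _ _ λ x → let y , y≈ = T⊆U x in begin
      cost U j                                     ≤⟨ cost-≤ U j y ⟩
      normᵥ g (columns A U *ᵥ y -ᵥ target j)       ≈⟨ normᵥ-cong (λ i → +-congʳ (y≈ i)) ⟩
      normᵥ g (columns A T *ᵥ x -ᵥ target j)       ∎

    cost-++ˡ : ∀ T U j → cost (T ++ U) j ≤ cost T j
    cost-++ˡ T U j = cost-mono T (T ++ U) j (columns-++ˡ A T U)

    cost-++ʳ : ∀ T U j → cost (T ++ U) j ≤ cost U j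
    cost-++ʳ T U j = cost-mono U (T ++ U) j (columns-++ʳ A T U)

    -- Covering all columns of a matrix near a low-rank one.

    module Cover (ati lin : Carrier) (0≤ati : 0# ≤ ati) (0<lin : 0# < lin) (growth : LinearGrowth g lin)
                 {k t} (1≤k : 1 ℕ.≤ k) (3k≤t : 3 ℕ.* k ℕ.≤ t) (triangle : ApproxTriangle g (suc t) ati)
                 (Â : Matrix n d) (rank : Rank≤ k Â) where
      open LossBounds F g ati lin
      open Growth 0<lin growth
      open ReproducingKernels F
      open SpanningSubsets F

      σ = √ℕ (3 ℕ.* k)

      mass : Fin d → Carrier
      mass j = Σ (allFin n) (λ i → fun (A i j - Â i j))

      mass-nonNegative : ∀ j → 0# ≤ mass j
      mass-nonNegative j = Σ-nonNegative (allFin n) (λ i → fun-nonNegative _)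

      1≤3k : 1 ℕ.≤ 3 ℕ.* k
      1≤3k = ℕ.≤-trans 1≤k (ℕ.m≤m+n k _)

      1≤σ : 1# ≤ σ
      1≤σ = 1≤√n 1≤3k

      0≤σ : 0# ≤ σ
      0≤σ = ≤-trans 0≤1 1≤σ

      fun0≈0 : fun 0# ≈ 0#
      fun0≈0 = fun-zero (ℕ.≤-trans 1≤3k 3k≤t) triangle 0≤ati

      -- In a basis of the column space of Â, the coordinates of its columns in L are at most k
      -- functions on L, and a list that reproduces them reproduces Â on L. The threshold μ comes
      -- after T because the choice of T does not depend on it.
      coverList : ∀ (L : List (Fin d)) →
        Σ[ T ∈ List (Fin d) ] length T ℕ.≤ 3 ℕ.* k ×
          (∀ μ → 0# ≤ μ → (∀ {l} → l ∈ L → mass l ≤ μ) → ∀ {j} → j ∈ L → lin * cost T j ≤ ati * (mass j + σ * μ))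
      coverList L = map (lookup L) T , ≡.subst (ℕ._≤ _) (≡.sym (List.length-map (lookup L) T)) ∣T∣≤3k ,
        λ μ 0≤μ mass≤μ {j} j∈L → ≡.subst (λ j → lin * cost (map (lookup L) T) j ≤ ati * (mass j + σ * μ))
          (≡.sym (lookup-index j∈L)) (bound (Any.index j∈L) μ 0≤μ mass≤μ)
        where
        k′ = proj₁ rank
        v  = proj₁ (proj₂ (proj₂ rank))
        Â∈span = proj₂ (proj₂ (proj₂ (proj₂ (proj₂ rank))))
        u : Fin k′ → Fin (length L) → Carrier
        u l q = proj₁ (Â∈span (lookup L q)) l
        spanning = wellConditionedSpanningList 1≤k (proj₁ (proj₂ rank)) u
        T = proj₁ spanning
        K = proj₁ (proj₂ spanning)
        ∣T∣≤3k = proj₁ (proj₂ (proj₂ spanning))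
        u∈ = proj₁ (proj₂ (proj₂ (proj₂ spanning)))
        ΣK²≤1 = proj₂ (proj₂ (proj₂ (proj₂ spanning)))

        Â-reproduced : ∀ i → Reproduces T K (λ q → Â i (lookup L q))
        Â-reproduced i q = begin-equality
          Â i (lookup L q)
            ≈⟨ Â≈ q ⟩
          Σ ls (λ l → u l q * v l i)
            ≈⟨ Σ-cong ls (λ l → trans (*-congʳ (u∈ l q)) (sym (Σ-*ʳ T _ _))) ⟩
          Σ ls (λ l → Σ T (λ t → u l t * K t q * v l i))
            ≈⟨ Σ-swap ls T _ ⟩
          Σ T (λ t → Σ ls (λ l → u l t * K t q * v l i))
            ≈⟨ Σ-cong T (λ t → trans (Σ-cong ls (λ l → solve 3 (λ x y z → x :* y :* z := x :* z :* y) refl _ _ _)) (Σ-*ʳ ls _ _)) ⟩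
          Σ T (λ t → Σ ls (λ l → u l t * v l i) * K t q)
            ≈⟨ Σ-cong T (λ t → *-congʳ (Â≈ t)) ⟨
          Σ T (λ t → Â i (lookup L t) * K t q) ∎
          where
          ls = allFin k′
          Â≈ : ∀ q → Â i (lookup L q) ≈ Σ ls (λ l → u l q * v l i)
          Â≈ q = trans (proj₂ (Â∈span (lookup L q)) i) (sum≈Σ (λ l → u l q * v l i))

        module _ (q : Fin (length L)) where
          j = lookup L q
          c : Fin (length L) → Carrier
          -- The sign is that of the regression target -a_j.
          c t = - K t q

          ∣c∣≤1 : ∀ {t} → t ∈ T → ∣ c t ∣ ≤ 1#
          ∣c∣≤1 {t} t∈T = x*x≤1⇒∣x∣≤1 (begin
            - K t q * - K t q          ≈⟨ solve 1 (λ x → (:- x) :* (:- x) := x :* x) refl _ ⟩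
            K t q * K t q              ≤⟨ Σ-member-≤ (λ t → square-nonNegative (K t q)) t∈T ⟩
            Σ T (λ t → K t q * K t q)  ≤⟨ ΣK²≤1 q ⟩
            1#                         ∎)

          -- Cauchy-Schwarz over at most 3k coefficients of square sum at most 1: the source of the
          -- factor √s.
          Σ∣c∣≤σ : Σ T (λ t → ∣ c t ∣) ≤ σ
          Σ∣c∣≤σ = x*x≤n⇒x≤√n {n = 3 ℕ.* k} (begin
            Σ T (λ t → ∣ c t ∣) * Σ T (λ t → ∣ c t ∣)
              ≤⟨ Σ-cauchySchwarz T (3 ℕ.* k) ∣T∣≤3k _ ⟩
            fromℕ (3 ℕ.* k) * Σ T (λ t → ∣ c t ∣ * ∣ c t ∣)
              ≈⟨ *-congˡ (Σ-cong T (λ t → trans (∣x∣*∣x∣≈x*x _) (solve 1 (λ x → (:- x) :* (:- x) := x :* x) refl _))) ⟩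
            fromℕ (3 ℕ.* k) * Σ T (λ t → K t q * K t q)
              ≤⟨ *-monoˡ-≤ (fromℕ-nonNegative (3 ℕ.* k)) (ΣK²≤1 q) ⟩
            fromℕ (3 ℕ.* k) * 1#
              ≈⟨ *-identityʳ _ ⟩
            fromℕ (3 ℕ.* k) ∎)

          x = columns-* A (lookup L) T c

          -- The columns of Â satisfy the linear relation exactly, so they cancel and only
          -- differences A - Â remain.
          residual≈ : ∀ i → (columns A (map (lookup L) T) *ᵥ proj₁ x) i - target j i ≈
            A i j - Â i j + Σ T (λ t → c t * (A i (lookup L t) - Â i (lookup L t)))
          residual≈ i = begin-equality
            (columns A (map (lookup L) T) *ᵥ proj₁ x) i - - A i j
              ≈⟨ +-congʳ (proj₂ x i) ⟩
            Σ T (λ t → A i (lookup L t) * c t) - - A i j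
              ≈⟨ solve 3 (λ s a b → s :- (:- a) := (a :- b) :+ (s :+ b)) refl _ _ _ ⟩
            A i j - Â i j + (Σ T (λ t → A i (lookup L t) * c t) + Â i j)
              ≈⟨ +-congˡ (trans (+-congˡ (Â-reproduced i q)) (sym (Σ-+ T _ _))) ⟩
            A i j - Â i j + Σ T (λ t → A i (lookup L t) * c t + Â i (lookup L t) * K t q)
              ≈⟨ +-congˡ (Σ-cong T (λ t → solve 3 (λ a b k → a :* (:- k) :+ b :* k := (:- k) :* (a :- b)) refl _ _ _)) ⟩
            A i j - Â i j + Σ T (λ t → c t * (A i (lookup L t) - Â i (lookup L t))) ∎

          bound : ∀ μ → 0# ≤ μ → (∀ {l} → l ∈ L → mass l ≤ μ) →
                  lin * cost (map (lookup L) T) j ≤ ati * (mass j + σ * μ)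
          bound μ 0≤μ mass≤μ = begin
            lin * cost (map (lookup L) T) j
              ≤⟨ *-monoˡ-≤ (proj₁ 0<lin) (cost-≤ (map (lookup L) T) j (proj₁ x)) ⟩
            lin * normᵥ g (columns A (map (lookup L) T) *ᵥ proj₁ x -ᵥ target j)
              ≈⟨ *-congˡ (trans (normᵥ≈Σ (columns A (map (lookup L) T) *ᵥ proj₁ x -ᵥ target j)) (Σ-cong rows (λ i → fun-cong (residual≈ i)))) ⟩
            lin * Σ rows (λ i → fun (A i j - Â i j + Σ T (λ t → c t * δ i t)))
              ≈⟨ Σ-*ˡ rows lin _ ⟨
            Σ rows (λ i → lin * fun (A i j - Â i j + Σ T (λ t → c t * δ i t)))
              ≤⟨ Σ-mono rows (λ i → combination-bound fun0≈0 triangle 0≤ati T (ℕ.≤-trans ∣T∣≤3k 3k≤t) _ c (δ i) ∣c∣≤1) ⟩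
            Σ rows (λ i → ati * (fun (A i j - Â i j) + Σ T (λ t → ∣ c t ∣ * fun (δ i t))))
              ≈⟨ trans (Σ-*ˡ rows ati _) (*-congˡ (Σ-+ rows _ _)) ⟩
            ati * (mass j + Σ rows (λ i → Σ T (λ t → ∣ c t ∣ * fun (δ i t))))
              ≈⟨ *-congˡ (+-congˡ (trans (Σ-swap rows T _) (Σ-cong T (λ t → Σ-*ˡ rows _ _)))) ⟩
            ati * (mass j + Σ T (λ t → ∣ c t ∣ * mass (lookup L t)))
              ≤⟨ *-monoˡ-≤ 0≤ati (+-monoʳ-≤ _ (begin
                   Σ T (λ t → ∣ c t ∣ * mass (lookup L t))
                     ≤⟨ Σ-mono T (λ t → *-monoˡ-≤ (∣x∣-nonNegative _) (mass≤μ (∈-lookup t))) ⟩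
                   Σ T (λ t → ∣ c t ∣ * μ)                  ≈⟨ Σ-*ʳ T μ _ ⟩
                   Σ T (λ t → ∣ c t ∣) * μ                  ≤⟨ *-monoʳ-≤ 0≤μ Σ∣c∣≤σ ⟩
                   σ * μ                                    ∎)) ⟩
            ati * (mass j + σ * μ) ∎
            where
            rows = allFin n
            δ : Fin n → Fin (length L) → Carrier
            δ i t = A i (lookup L t) - Â i (lookup L t)

      open Halving (On.decTotalOrder decTotalOrder mass)

      -- The term with ν pays for covering the lower half L of a superset of R by columns of mass
      -- at most ν: then ∣L∣ ≤ ∣R∣, and σ ∣L∣ ν is available.
      coverAll : ∀ h (R : List (Fin d)) → length R ℕ.≤ 2 ℕ.^ h →
        Σ[ T ∈ List (Fin d) ] length T ℕ.≤ 3 ℕ.* k ℕ.* suc h ×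
          (∀ ν → (∀ {j} → j ∈ R → ν ≤ mass j) →
           lin * Σ R (cost T) + ati * (σ * (fromℕ (length R) * ν)) ≤ ati * ((1# + (σ + σ)) * Σ R mass))
      coverAll h [] _ = [] , ℕ.z≤n , λ ν _ → ≤-reflexive
        (solve 4 (λ l a s n → l :* con 0ℤ :+ a :* (s :* (con 0ℤ :* n)) := a :* ((:1 :+ (s :+ s)) :* con 0ℤ)) refl lin ati σ ν)
      coverAll zero (j ∷ []) _ = T , ≡.subst (length T ℕ.≤_) (≡.sym (ℕ.*-identityʳ (3 ℕ.* k))) ∣T∣≤3k , λ ν ν≤ → begin
        lin * (cost T j + 0#) + ati * (σ * ((1# + 0#) * ν))
          ≈⟨ solve 5 (λ l c a s n → l :* (c :+ con 0ℤ) :+ a :* (s :* ((:1 :+ con 0ℤ) :* n)) := l :* c :+ a :* (s :* n)) refl _ _ _ _ _ ⟩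
        lin * cost T j + ati * (σ * ν)
          -- A single column is its own threshold. Covering it and paying for ν ≤ `mass j` each cost
          -- σ · `mass j`, which gives the factor 1 + 2σ.
          ≤⟨ +-mono-≤ (T-covers (mass j) (mass-nonNegative j) (λ { (here ≡.refl) → ≤-refl }) (here ≡.refl))
               (*-monoˡ-≤ 0≤ati (*-monoˡ-≤ 0≤σ (ν≤ (here ≡.refl)))) ⟩
        ati * (mass j + σ * mass j) + ati * (σ * mass j)
          ≈⟨ solve 3 (λ a s m → a :* (m :+ s :* m) :+ a :* (s :* m) := a :* ((:1 :+ (s :+ s)) :* (m :+ con 0ℤ))) refl _ _ _ ⟩
        ati * ((1# + (σ + σ)) * (mass j + 0#)) ∎
        where
        covered = coverList (j ∷ [])
        T = proj₁ covered
        ∣T∣≤3k = proj₁ (proj₂ covered)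
        T-covers = proj₂ (proj₂ covered)
      coverAll zero (_ ∷ _ ∷ _) (ℕ.s≤s ())
      coverAll (suc h) R@(_ ∷ _) ∣R∣≤2^[1+h] with halve R
      -- The upper half has ⌈n/2⌉ elements, so it is nonempty when R is.
      ... | _ , [] , _ , _ , () , _
      ... | L , U@(u ∷ _) , R↭L++U , ∣L∣≡ , ∣U∣≡ , L≤U , u≤U ∷ _ = T ++ V , ∣T++V∣≤ , bound
        where
        covered = coverList L
        T = proj₁ covered
        T-covers = proj₂ (proj₂ covered)
        rec = coverAll h U (≡.subst (ℕ._≤ 2 ℕ.^ h) (≡.sym ∣U∣≡) (n≤2m⇒⌈n/2⌉≤m ∣R∣≤2^[1+h]))
        V = proj₁ rec
        ∣T++V∣≤ : length (T ++ V) ℕ.≤ 3 ℕ.* k ℕ.* suc (suc h)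
        ∣T++V∣≤ = ≡.subst₂ ℕ._≤_ (≡.sym (List.length-++ T)) (≡.sym (ℕ.*-suc (3 ℕ.* k) (suc h)))
          (ℕ.+-mono-≤ (proj₁ (proj₂ covered)) (proj₁ (proj₂ rec)))
        μ = mass u
        a = fromℕ (length L)
        b = fromℕ (length U)
        bound : ∀ ν → (∀ {j} → j ∈ R → ν ≤ mass j) →
          lin * Σ R (cost (T ++ V)) + ati * (σ * (fromℕ (length R) * ν)) ≤ ati * ((1# + (σ + σ)) * Σ R mass)
        bound ν ν≤ = begin
          lin * Σ R (cost (T ++ V)) + ati * (σ * (fromℕ (length R) * ν))
            ≈⟨ +-cong (*-congˡ (trans (Σ-↭ R↭L++U _) (Σ-++ L U _))) (*-congˡ (*-congˡ (*-congʳ ∣R∣≈))) ⟩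
          lin * (Σ L (cost (T ++ V)) + Σ U (cost (T ++ V))) + ati * (σ * ((a + b) * ν))
            ≤⟨ +-monoˡ-≤ _ (*-monoˡ-≤ (proj₁ 0<lin) (+-mono-≤ (Σ-mono L (cost-++ˡ T V)) (Σ-mono U (cost-++ʳ T V)))) ⟩
          lin * (Σ L (cost T) + Σ U (cost V)) + ati * (σ * ((a + b) * ν))
            -- σ b μ is added and subtracted: the recursive bound for U is used with payment μ
            -- instead of ν.
            ≈⟨ solve 9 (λ l x y at s a b n m → l :* (x :+ y) :+ at :* (s :* ((a :+ b) :* n)) :=
                 l :* x :+ (l :* y :+ at :* (s :* (b :* m))) :+ at :* (s :* (a :* n :+ b :* n :- b :* m)))
                 refl lin _ _ ati σ a b ν μ ⟩
          lin * Σ L (cost T) + (lin * Σ U (cost V) + ati * (σ * (b * μ))) + ati * (σ * (a * ν + b * ν - b * μ))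
            ≤⟨ +-mono-≤ (+-mono-≤ L-bound U-bound) (*-monoˡ-≤ 0≤ati (*-monoˡ-≤ 0≤σ slack)) ⟩
          ati * (Σ L mass + σ * (a * μ)) + ati * ((1# + (σ + σ)) * Σ U mass) + ati * (σ * (Σ L mass + Σ L mass - a * μ))
            ≈⟨ solve 5 (λ at s m am n → at :* (m :+ s :* am) :+ at :* ((:1 :+ (s :+ s)) :* n) :+ at :* (s :* (m :+ m :- am)) :=
                 at :* ((:1 :+ (s :+ s)) :* (m :+ n))) refl ati σ (Σ L mass) (a * μ) (Σ U mass) ⟩
          ati * ((1# + (σ + σ)) * (Σ L mass + Σ U mass))
            ≈⟨ *-congˡ (*-congˡ (trans (Σ-↭ R↭L++U _) (Σ-++ L U _))) ⟨
          ati * ((1# + (σ + σ)) * Σ R mass) ∎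
          where
          ν≤μ : ν ≤ μ
          ν≤μ = ν≤ (↭.∈-resp-↭ (↭-sym R↭L++U) (∈-++⁺ʳ L (here ≡.refl)))
          ∣R∣≈ : fromℕ (length R) ≈ a + b
          ∣R∣≈ = trans (reflexive (≡.cong fromℕ (≡.trans (↭.↭-length R↭L++U) (List.length-++ L)))) (fromℕ-+ (length L) (length U))
          a≤b : a ≤ b
          a≤b = fromℕ-mono-≤ (≡.subst₂ ℕ._≤_ (≡.sym ∣L∣≡) (≡.sym ∣U∣≡) (ℕ.⌊n/2⌋≤⌈n/2⌉ (length R)))
          aν≤ΣL : a * ν ≤ Σ L mass
          aν≤ΣL = ≤-respˡ-≈ (Σ-const L ν) (Σ-mono-∈ L (λ l∈L → ν≤ (↭.∈-resp-↭ (↭-sym R↭L++U) (∈-++⁺ˡ l∈L))))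
          -- As a ≤ b and ν ≤ μ, the payment in ν minus the one passed on to U is at most 2aν - aμ,
          -- and aν is at most the mass of L. The remaining -aμ cancels the price σ a μ of covering
          -- L.
          slack : a * ν + b * ν - b * μ ≤ Σ L mass + Σ L mass - a * μ
          slack = begin
            a * ν + b * ν - b * μ
              ≈⟨ solve 4 (λ a b n m → a :* n :+ b :* n :- b :* m := a :* n :+ a :* n :- a :* m :- (b :- a) :* (m :- n)) refl a b ν μ ⟩
            a * ν + a * ν - a * μ - (b - a) * (μ - ν)
              ≤⟨ +-mono-≤ (+-monoˡ-≤ _ (+-mono-≤ aν≤ΣL aν≤ΣL)) (0≤x⇒-x≤0 (*-nonNegative (x≤y⇒0≤y-x a≤b) (x≤y⇒0≤y-x ν≤μ))) ⟩
            Σ L mass + Σ L mass - a * μ + 0#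
              ≈⟨ +-identityʳ _ ⟩
            Σ L mass + Σ L mass - a * μ ∎
          L-bound : lin * Σ L (cost T) ≤ ati * (Σ L mass + σ * (a * μ))
          L-bound = begin
            lin * Σ L (cost T)                        ≈⟨ Σ-*ˡ L lin _ ⟨
            Σ L (λ j → lin * cost T j)
              ≤⟨ Σ-mono-∈ L (T-covers μ (mass-nonNegative u) (λ l∈L → L≤U l∈L (here ≡.refl))) ⟩
            Σ L (λ j → ati * (mass j + σ * μ))
              ≈⟨ trans (Σ-*ˡ L ati _) (*-congˡ (trans (Σ-+ L _ _) (+-congˡ (Σ-const L _)))) ⟩
            ati * (Σ L mass + a * (σ * μ))
              ≈⟨ *-congˡ (+-congˡ (solve 3 (λ a s m → a :* (s :* m) := s :* (a :* m)) refl _ _ _)) ⟩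
            ati * (Σ L mass + σ * (a * μ))            ∎
          -- The recursive bound at ν = μ is available because u heads the sorted upper half, so μ
          -- is the least mass there.
          U-bound : lin * Σ U (cost V) + ati * (σ * (b * μ)) ≤ ati * ((1# + (σ + σ)) * Σ U mass)
          U-bound = proj₂ (proj₂ rec) μ μ≤U
            where
            μ≤U : ∀ {j} → j ∈ U → μ ≤ mass j
            μ≤U (here ≡.refl) = ≤-refl
            μ≤U (there j∈U)   = All.lookup u≤U j∈U

-- Logarithms, and enumeration of lists of bounded length.

n≤2^⌈log₂n⌉ : ∀ n → n ℕ.≤ 2 ℕ.^ ⌈log₂ n ⌉
n≤2^⌈log₂n⌉ = <-rec _ step
  where
  step : ∀ n → (∀ {m} → m ℕ.< n → m ℕ.≤ 2 ℕ.^ ⌈log₂ m ⌉) → n ℕ.≤ 2 ℕ.^ ⌈log₂ n ⌉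
  step zero          rec = ℕ.z≤n
  step (suc zero)    rec = ℕ.s≤s ℕ.z≤n
  step n@(suc (suc n-2)) rec = begin
    n                                  ≡⟨ ℕ.⌊n/2⌋+⌈n/2⌉≡n n ⟨
    ℕ.⌊ n /2⌋ ℕ.+ ℕ.⌈ n /2⌉            ≤⟨ ℕ.+-monoˡ-≤ _ (ℕ.⌊n/2⌋≤⌈n/2⌉ n) ⟩
    ℕ.⌈ n /2⌉ ℕ.+ ℕ.⌈ n /2⌉            ≡⟨ ≡.cong (ℕ.⌈ n /2⌉ ℕ.+_) (ℕ.+-identityʳ _) ⟨
    2 ℕ.* ℕ.⌈ n /2⌉                    ≤⟨ ℕ.*-monoʳ-≤ 2 (rec (ℕ.⌈n/2⌉<n n-2)) ⟩
    2 ℕ.* 2 ℕ.^ ⌈log₂ ℕ.⌈ n /2⌉ ⌉      ≡⟨ ≡.cong (λ e → 2 ℕ.* 2 ℕ.^ e) (⌈log₂⌈n/2⌉⌉≡⌈log₂n⌉∸1 n) ⟩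
    2 ℕ.^ suc (⌈log₂ n ⌉ ℕ.∸ 1)
      ≡⟨ ≡.cong (2 ℕ.^_) (ℕ.m+[n∸m]≡n {1} (⌈log₂⌉-mono-≤ {2} {n} (ℕ.s≤s (ℕ.s≤s ℕ.z≤n)))) ⟩
    2 ℕ.^ ⌈log₂ n ⌉                    ∎
    where open ℕ.≤-Reasoning

1≤log : ∀ n → 1 ℕ.≤ log n
1≤log n = ℕ.m≤m⊔n 1 ⌈log₂ n ⌉

-- The round of the base case, counted by `suc`, is absorbed because the logarithm is truncated
-- below at 1.
1+⌈log₂n⌉≤2log : ∀ n → suc ⌈log₂ n ⌉ ℕ.≤ 2 ℕ.* log n
1+⌈log₂n⌉≤2log n = ℕ.+-mono-≤ (1≤log n) (ℕ.≤-trans (ℕ.m≤n⊔m 1 ⌈log₂ n ⌉) (ℕ.m≤m+n _ 0))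

listsUpTo : ∀ {A : Set} → ℕ → List A → List (List A)
listsUpTo N xs = concatMap (λ n → tuples n xs) (upTo (suc N))

∈-listsUpTo⁺ : ∀ {A : Set} {xs : List A} N → (∀ x → x ∈ xs) → ∀ {ys} → length ys ℕ.≤ N → ys ∈ listsUpTo N xs
∈-listsUpTo⁺ {xs = xs} N all {ys} ∣ys∣≤N = ∈-concatMap⁺ (λ n → tuples n xs) {xs = upTo (suc N)}
  (lose (∈-upTo⁺ (ℕ.s≤s ∣ys∣≤N)) (∈-tuples⁺ all ys))

length-listsUpTo : ∀ {A : Set} {xs : List A} N {ys} → ys ∈ listsUpTo N xs → length ys ℕ.≤ N
length-listsUpTo {xs = xs} N ys∈ with find (∈-concatMap⁻ (λ n → tuples n xs) {xs = upTo (suc N)} ys∈)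
... | n , n∈ , ys∈tuples = ≡.subst (ℕ._≤ N) (≡.sym (length-tuples n ys∈tuples)) (ℕ.≤-pred (∈-upTo⁻ n∈))

-- Passing from lists of columns to subsets.

support : ∀ {d} → List (Fin d) → Subset d
support []      = Subset.⊥
support (t ∷ T) = ⁅ t ⁆ ∪ support T

∣p∪q∣≤∣p∣+∣q∣ : ∀ {d} (p q : Subset d) → Subset.∣ p ∪ q ∣ ℕ.≤ Subset.∣ p ∣ ℕ.+ Subset.∣ q ∣
∣p∪q∣≤∣p∣+∣q∣ []            []            = ℕ.z≤n
∣p∪q∣≤∣p∣+∣q∣ (outside ∷ p) (outside ∷ q) = ∣p∪q∣≤∣p∣+∣q∣ p q
∣p∪q∣≤∣p∣+∣q∣ (outside ∷ p) (inside  ∷ q) =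
  ℕ.≤-trans (ℕ.s≤s (∣p∪q∣≤∣p∣+∣q∣ p q)) (ℕ.≤-reflexive (≡.sym (ℕ.+-suc _ _)))
∣p∪q∣≤∣p∣+∣q∣ (inside  ∷ p) (outside ∷ q) = ℕ.s≤s (∣p∪q∣≤∣p∣+∣q∣ p q)
∣p∪q∣≤∣p∣+∣q∣ (inside  ∷ p) (inside  ∷ q) =
  ℕ.s≤s (ℕ.≤-trans (∣p∪q∣≤∣p∣+∣q∣ p q) (ℕ.+-monoʳ-≤ _ (ℕ.n≤1+n _)))

∣support∣≤length : ∀ {d} (T : List (Fin d)) → Subset.∣ support T ∣ ℕ.≤ length T
∣support∣≤length {d} [] = ℕ.≤-reflexive (Subset.∣⊥∣≡0 d)
∣support∣≤length (t ∷ T) = begin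
  Subset.∣ ⁅ t ⁆ ∪ support T ∣                 ≤⟨ ∣p∪q∣≤∣p∣+∣q∣ ⁅ t ⁆ (support T) ⟩
  Subset.∣ ⁅ t ⁆ ∣ ℕ.+ Subset.∣ support T ∣
    ≤⟨ ℕ.+-mono-≤ (ℕ.≤-reflexive (Subset.∣⁅x⁆∣≡1 t)) (∣support∣≤length T) ⟩
  suc (length T)                               ∎
  where open ℕ.≤-Reasoning

module ColumnFits (F : OrderedField) where
  open OrderedField F
  open OrderedFieldProperties F
  open ListSums F
  open Matrices F
  open Columns F
  open CommutativeMonoidSum +-commutativeMonoid using (sum-cong-≋; ∑-distrib-+)

  single : ∀ {d} → Fin d → Carrier → Fin d → Carrier
  single t x j = if does (t Fin.≟ j) then x else 0#

  -- Coefficients of a repeated column add up, so a combination over the list becomes one over its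
  -- support.
  weights : ∀ {d} (T : List (Fin d)) → Vector Carrier (length T) → Fin d → Carrier
  weights []      x j = 0#
  weights (t ∷ T) x j = single t (x zero) j + weights T (x ∘ suc) j

  weights-outside : ∀ {d} (T : List (Fin d)) x {j} → ¬ j Subset.∈ support T → weights T x j ≈ 0#
  weights-outside []      x j∉ = refl
  weights-outside (t ∷ T) x {j} j∉ with t Fin.≟ j
  ... | yes ≡.refl = ⊥-elim (j∉ (Subset.p⊆p∪q (support T) (Subset.x∈⁅x⁆ t)))
  ... | no  _      = trans (+-identityˡ _) (weights-outside T (x ∘ suc) (j∉ ∘ Subset.q⊆p∪q ⁅ t ⁆ (support T)))

  sum-*0 : ∀ {d} (a : Fin d → Carrier) → sum (λ j → a j * 0#) ≈ 0#
  sum-*0 {d} a = trans (sum≈Σ (λ j → a j * 0#)) (trans (Σ-cong (allFin d) (λ j → zeroʳ (a j))) (Σ-zero (allFin d)))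

  sum-single : ∀ {d} (a : Fin d → Carrier) t x → sum (λ j → a j * single t x j) ≈ a t * x
  sum-single a zero    x = trans (+-congˡ (sum-*0 (a ∘ suc))) (+-identityʳ _)
  sum-single a (suc t) x = trans (+-cong (zeroʳ _) (sum-single (a ∘ suc) t x)) (+-identityˡ _)

  sum-weights : ∀ {n d} (A : Matrix n d) T x i → sum (λ j → A i j * weights T x j) ≈ (columns A T *ᵥ x) i
  sum-weights A []      x i = sum-*0 (A i)
  sum-weights A (t ∷ T) x i = begin-equality
    sum (λ j → A i j * (single t (x zero) j + weights T (x ∘ suc) j))
      ≈⟨ trans (sum-cong-≋ (λ j → distribˡ (A i j) _ _)) (∑-distrib-+ (λ j → A i j * single t (x zero) j) _) ⟩
    sum (λ j → A i j * single t (x zero) j) + sum (λ j → A i j * weights T (x ∘ suc) j)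
      ≈⟨ +-cong (sum-single (A i) t (x zero)) (sum-weights A T (x ∘ suc) i) ⟩
    (columns A (t ∷ T) *ᵥ x) i ∎

  sumOver≈sum : ∀ {d} (S : Subset d) (f : Fin d → Carrier) → (∀ {j} → ¬ j Subset.∈ S → f j ≈ 0#) →
                sumOver S (f ∘ proj₁) ≈ sum f
  sumOver≈sum {d} S f f≈0 = sum-cong-≋ pointwise
    where
    -- The summands of `sumOver` are local to its definition; unification against `refl` gives
    -- access to them.
    summands : Σ[ v ∈ Vector Carrier d ] sumOver S (f ∘ proj₁) ≡ sum v
    summands = _ , ≡.refl
    pointwise : ∀ j → proj₁ summands j ≈ f j
    pointwise j with j Subset.∈? S
    ... | yes _   = refl
    ... | no  j∉S = sym (f≈0 j∉S)

  mulOver-weights : ∀ {n d e} (A : Matrix n d) T (x : Fin e → Vector Carrier (length T)) i l →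
    mulOver (support T) (A ∣^ support T) (λ (j , _) l → weights T (x l) j) i l ≈ (columns A T *ᵥ x l) i
  mulOver-weights A T x i l = trans
    (sumOver≈sum (support T) (λ j → A i j * weights T (x l) j)
      (λ j∉ → trans (*-congˡ (weights-outside T (x l) j∉)) (zeroʳ _)))
    (sum-weights A T (x l) i)

-- Exhaustive search with the regression solver.

module ExhaustiveSearch (F : OrderedField) (g : OrderedField.Carrier F → OrderedField.Carrier F)
                        {n d} (solve : Matrices.RegressionSolver F n) (A : Matrices.Matrix F n d) where
  open OrderedField F
  open Matrices F
  open ListSums F
  open Columns F
  open ColumnFits F
  open Extrema (DecTotalOrder.totalOrder decTotalOrder)

  -- Regression is run against -a_l and its answer negated, which turns the residual bounded by the
  -- solver into a_l - B x.
  coefficients : (T : List (Fin d)) → Fin d → Vector Carrier (length T)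
  coefficients T l q = - solve (length T) (columns A T) (λ i → - A i l) q

  -- The loss actually achieved by the solver, computed from field operations and g alone, so the
  -- algorithm can compare candidates without knowing any infimum.
  error : List (Fin d) → Carrier
  error T = Σ (allFin d) (λ l → Σ (allFin n) (λ i → g (A i l - (columns A T *ᵥ coefficients T l) i)))

  best : ℕ → List (Fin d)
  best N = argmin error [] (listsUpTo N (allFin d))

  length-best : ∀ N → length (best N) ℕ.≤ N
  length-best N = argmin-all error {P = λ T → length T ℕ.≤ N} ℕ.z≤n (All.tabulate (length-listsUpTo N))

  error-best : ∀ N {T} → length T ℕ.≤ N → error (best N) ≤ error T
  error-best N {T} ∣T∣≤N = All.lookup (f[argmin]≤f[xs] {f = error} [] (listsUpTo N (allFin d))) (∈-listsUpTo⁺ N ∈-allFin {T} ∣T∣≤N)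

-- The selection algorithm and the number of columns it uses.

budget : ℕ → ℕ → ℕ
budget k d = 2 ℕ.* (3 ℕ.* k ℕ.* log d)

selectColumns : ColumnSelectionAlgorithm
selectColumns F g {d = d} solve A k =
  support T , λ (j , _) l → weights T (coefficients T l) j
  where
  open ColumnFits F using (weights)
  open ExhaustiveSearch F g solve A
  T = best (budget k d)

coverSize≤budget : ∀ k d → 3 ℕ.* k ℕ.* suc ⌈log₂ d ⌉ ℕ.≤ budget k d
coverSize≤budget k d = begin
  3 ℕ.* k ℕ.* suc ⌈log₂ d ⌉     ≤⟨ ℕ.*-monoʳ-≤ (3 ℕ.* k) (1+⌈log₂n⌉≤2log d) ⟩
  3 ℕ.* k ℕ.* (2 ℕ.* log d)     ≡⟨ regroup (3 ℕ.* k) (log d) ⟩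
  budget k d                    ∎
  where
  open ℕ.≤-Reasoning
  regroup : ∀ x y → x ℕ.* (2 ℕ.* y) ≡ 2 ℕ.* (x ℕ.* y)
  regroup = solve-∀

x≤x*y : ∀ x {y} → 1 ℕ.≤ y → x ℕ.≤ x ℕ.* y
x≤x*y x {y} 1≤y = ≡.subst (ℕ._≤ x ℕ.* y) (ℕ.*-identityʳ x) (ℕ.*-monoʳ-≤ x 1≤y)

3k≤6[k*loglog] : ∀ k → 3 ℕ.* k ℕ.≤ 6 ℕ.* (k ℕ.* loglog k)
3k≤6[k*loglog] k = ℕ.*-mono-≤ {3} {6} (ℕ.m≤m+n 3 3) (x≤x*y k (1≤log (log k)))

-- The budget equals 6 k log d; the remaining factors are truncated logarithms, each at least 1.
budget≤ : ∀ k d → budget k d ℕ.≤ 6 ℕ.* (k ℕ.* loglog k ℕ.* log d ℕ.^ 2)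
budget≤ k d = begin
  2 ℕ.* (3 ℕ.* k ℕ.* log d)                     ≡⟨ regroup k (log d) ⟩
  6 ℕ.* (k ℕ.* log d)                           ≤⟨ ℕ.*-monoʳ-≤ 6 (ℕ.*-mono-≤ (x≤x*y k (1≤log (log k)))
                                                     (x≤x*y (log d) (≡.subst (1 ℕ.≤_) (≡.sym (ℕ.*-identityʳ (log d))) (1≤log d)))) ⟩
  6 ℕ.* (k ℕ.* loglog k ℕ.* log d ℕ.^ 2)        ∎
  where
  open ℕ.≤-Reasoning
  regroup : ∀ x y → 2 ℕ.* (3 ℕ.* x ℕ.* y) ≡ 6 ℕ.* (x ℕ.* y)
  regroup = solve-∀

-- Analysis of the selected columns.

module Analysis
  (F : OrderedField) (complete : Complete F) (g : Matrices.Loss F) (ati lin : OrderedField.Carrier F)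
  (reg : ℕ → OrderedField.Carrier F) {n d} (solve : Matrices.RegressionSolver F n) (A : Matrices.Matrix F n d)
  where
  open OrderedField F
  open OrderedFieldProperties F renaming (solve to ring-solve)
  open ListSums F
  open Matrices F
  open Reals F complete
  open RealProperties F complete
  open Columns F
  open ColumnFits F
  open Cost g A
  open Loss g using (fun) renaming (cong to fun-cong; nonNegative to fun-nonNegative)
  open LossBounds F g ati lin using (triangle-list; Σ-replicate)
  open ExhaustiveSearch F fun solve A

  norm≈Σ : ∀ {p q} (M : Matrix p q) → norm g M ≈ Σ (allFin q) (λ j → Σ (allFin p) (λ i → fun (M i j)))
  norm≈Σ {p} {q} M = begin-equality
    norm g M                                              ≈⟨ sum≈Σ (λ i → sum (λ j → fun (M i j))) ⟩
    Σ (allFin p) (λ i → sum (λ j → fun (M i j)))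
      ≈⟨ Σ-cong (allFin p) (λ i → sum≈Σ (λ j → fun (M i j))) ⟩
    Σ (allFin p) (λ i → Σ (allFin q) (λ j → fun (M i j))) ≈⟨ Σ-swap (allFin p) (allFin q) _ ⟩
    Σ (allFin q) (λ j → Σ (allFin p) (λ i → fun (M i j))) ∎

  error≈ : ∀ T → error T ≈ Σ (allFin d) (λ l → normᵥ g (columns A T *ᵥ solve (length T) (columns A T) (target l) -ᵥ target l))
  error≈ T = Σ-cong (allFin d) (λ l → sym (trans (normᵥ≈Σ (columns A T *ᵥ solve (length T) (columns A T) (target l) -ᵥ target l))
    (Σ-cong (allFin n) (λ i → fun-cong (negated l i)))))
    where
    negated : ∀ l i → (columns A T *ᵥ solve (length T) (columns A T) (target l)) i - target l i ≈
                      A i l - (columns A T *ᵥ coefficients T l) i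
    negated l i = begin-equality
      s - - A i l            ≈⟨ ring-solve 2 (λ s a → s :- (:- a) := a :- (:- s)) refl s (A i l) ⟩
      A i l - - s
        ≈⟨ +-congˡ (-‿cong (trans (-‿cong (sum≈Σ (λ q → B i q * x q))) (sym (Σ-neg qs _)))) ⟩
      A i l - Σ qs (λ q → - (B i q * x q))
        ≈⟨ +-congˡ (-‿cong (Σ-cong qs (λ q → ring-solve 2 (λ b x → :- (b :* x) := b :* (:- x)) refl _ _))) ⟩
      A i l - Σ qs (λ q → B i q * - x q)     ≈⟨ +-congˡ (-‿cong (sum≈Σ (λ q → B i q * - x q))) ⟨
      A i l - (B *ᵥ coefficients T l) i ∎
      where
      B = columns A T
      x = solve (length T) B (target l)
      s = (B *ᵥ x) i
      qs = allFin (length T)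

  approximation : ℕ → Matrix n d
  approximation N = mulOver (support (best N)) (A ∣^ support (best N))
                            (λ (j , _) l → weights (best N) (coefficients (best N) l) j)

  norm-best : ∀ N → norm g (A -ₘ approximation N) ≈ error (best N)
  norm-best N = trans (norm≈Σ (A -ₘ approximation N)) (Σ-cong (allFin d) (λ l → Σ-cong (allFin n) (λ i →
    fun-cong (+-congˡ (-‿cong (mulOver-weights A (best N) (coefficients (best N)) i l))))))

  -- The minimum is an infimum that need not be attained. For C > 0 the bound is divided by C; for C
  -- ≤ 0 multiplication reverses the order, and the single competitor 0 suffices.
  ≤*minLowRank : ∀ k {x C} → (∀ (Â : Matrix n d) → Rank≤ k Â → x ≤ C * norm g (A -ₘ Â)) →
                 x ≤ C * minLowRank g k A
  ≤*minLowRank k {x} {C} x≤ with C ≤? 0#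
  ... | yes C≤0 = begin
    x                        ≤⟨ x≤ 0ₘ (0ₘ-rank≤ k) ⟩
    C * norm g (A -ₘ 0ₘ)     ≈⟨ ring-solve 2 (λ c y → c :* y := :- ((:- c) :* y)) refl _ _ ⟩
    - (- C * norm g (A -ₘ 0ₘ))
      ≤⟨ -‿anti-≤ (*-monoˡ-≤ (x≤0⇒0≤-x C≤0) (inf-lower {I = Σ[ Â ∈ Matrix n d ] Rank≤ k Â} _ _ _ (0ₘ , 0ₘ-rank≤ k))) ⟩
    - (- C * minLowRank g k A)  ≈⟨ ring-solve 2 (λ c y → :- ((:- c) :* y) := c :* y) refl _ _ ⟩
    C * minLowRank g k A     ∎
  ... | no C≰0 = begin
    x                         ≈⟨ x⁻¹*[x*y]≈y (>⇒≉ 0<C) x ⟨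
    C ⁻¹ * (C * x)            ≈⟨ ring-solve 3 (λ b c x → b :* (c :* x) := c :* (b :* x)) refl _ _ _ ⟩
    C * (C ⁻¹ * x)
      ≤⟨ *-monoˡ-≤ (proj₁ 0<C) (inf-greatest {I = Σ[ Â ∈ Matrix n d ] Rank≤ k Â} _ _ _
                                  (λ (Â , rank) → ≤-respʳ-≈ (x⁻¹*[x*y]≈y (>⇒≉ 0<C) _) (*-monoˡ-≤ (⁻¹-nonNegative 0<C) (x≤ Â rank)))) ⟩
    C * minLowRank g k A      ∎
    where
    0<C : 0# < C
    0<C = ≰⇒> C≰0

  -- The constants `ati` and `reg` carry no sign. A negative one forces every loss of a vector of
  -- length n to vanish, and then the claim compares 0 with 0.
  Degenerate : Set
  Degenerate = ∀ (v : Vector Carrier n) → normᵥ g v ≈ 0#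

  degenerate⇒norm≈0 : Degenerate → ∀ {q} (M : Matrix n q) → norm g M ≈ 0#
  degenerate⇒norm≈0 degenerate {q} M = trans (norm≈Σ M) (trans
    (Σ-cong (allFin q) (λ j → trans (sym (normᵥ≈Σ (column M j))) (degenerate (column M j)))) (Σ-zero (allFin q)))

  degenerate⇒≤ : Degenerate → ∀ k {C} (M : Matrix n d) → norm g M ≤ C * minLowRank g k A
  degenerate⇒≤ degenerate k {C} M = ≤*minLowRank k λ Â _ → begin
    norm g M              ≈⟨ degenerate⇒norm≈0 degenerate M ⟩
    0#                    ≈⟨ zeroʳ C ⟨
    C * 0#                ≈⟨ *-congˡ (degenerate⇒norm≈0 degenerate (A -ₘ Â)) ⟨
    C * norm g (A -ₘ Â)   ∎

  -- The triangle inequality for x, 0, ..., 0 bounds g(x) by `ati` times a nonnegative sum.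
  ati≤0⇒degenerate : ∀ {t} → ApproxTriangle g (suc t) ati → ati ≤ 0# → Degenerate
  ati≤0⇒degenerate {t} triangle ati≤0 v =
    trans (normᵥ≈Σ v) (trans (Σ-cong (allFin n) (λ i → ≤-antisym (fun≤0 (v i)) (fun-nonNegative _))) (Σ-zero (allFin n)))
    where
    fun≤0 : ∀ x → fun x ≤ 0#
    fun≤0 x = begin
      fun x
        ≈⟨ fun-cong (trans (+-congˡ (trans (Σ-replicate t 0# id) (zeroʳ _))) (+-identityʳ x)) ⟨
      fun (Σ xs id)       ≤⟨ triangle-list triangle xs (≡.cong suc (List.length-replicate t)) ⟩
      ati * Σ xs fun      ≤⟨ *-monoʳ-≤ (Σ-nonNegative xs fun-nonNegative) ati≤0 ⟩
      0# * Σ xs fun       ≈⟨ zeroˡ _ ⟩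
      0#                  ∎
      where xs = x ∷ replicate t 0#

  -- With the zero matrix and target -v, the residual is v whatever the solver returns.
  reg≤0⇒degenerate : SolvesRegression g reg solve → ∀ {m} → reg m ≤ 0# → Degenerate
  reg≤0⇒degenerate solves {m} reg≤0 v = ≤-antisym (begin
    normᵥ g v
      ≈⟨ normᵥ-cong {v = v} {w = B *ᵥ solve m B b -ᵥ b} (λ i → sym (trans
                                                        (+-congʳ (trans (sum≈Σ (λ q → 0# * x q)) (trans (Σ-cong (allFin m) (λ q → zeroˡ _)) (Σ-zero (allFin m)))))
                                                        (ring-solve 1 (λ v → con 0ℤ :- (:- v) := v) refl (v i)))) ⟩
    normᵥ g (B *ᵥ solve m B b -ᵥ b)                ≤⟨ solves m B b ⟩
    reg m * minRegression g B b
      ≤⟨ *-monoʳ-≤ (inf-greatest _ _ _ (λ y → normᵥ-nonNegative g (B *ᵥ y -ᵥ b))) reg≤0 ⟩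
    0# * minRegression g B b                       ≈⟨ zeroˡ _ ⟩
    0#                                             ∎) (normᵥ-nonNegative g v)
    where
    B : Matrix n m
    B _ _ = 0#
    b : Vector Carrier n
    b i = - v i
    x = solve m B b

  module _ {k t} (1≤k : 1 ℕ.≤ k) (3k≤t : 3 ℕ.* k ℕ.≤ t) (triangle : ApproxTriangle g (suc t) ati)
           (0<lin : 0# < lin) (growth : LinearGrowth g lin)
           (reg-mono : ∀ {p q} → p ℕ.≤ q → reg p ≤ reg q) (solves : SolvesRegression g reg solve) where

    private
      N = budget k d
      ρ = reg N
      σ = √ℕ (3 ℕ.* k)
      C = fromℕ 6 * σ * (ρ * ati / lin)

    -- The search does at least as well as the cover T, which fits the budget. On T the solver loses
    -- at most the factor ρ per column, as `reg` is nondecreasing.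
    error-≤ : 0# ≤ ati → 0# ≤ ρ → ∀ Â → Rank≤ k Â → error (best N) ≤ C * norm g (A -ₘ Â)
    error-≤ 0≤ati 0≤ρ Â rank = *-cancelˡ-≤ 0<lin (begin
      lin * error (best N)
        ≤⟨ *-monoˡ-≤ 0≤lin (error-best N {T} (ℕ.≤-trans ∣T∣≤ (coverSize≤budget k d))) ⟩
      lin * error T
        ≈⟨ *-congˡ (error≈ T) ⟩
      lin * Σ (allFin d) (λ l → normᵥ g (columns A T *ᵥ solve (length T) (columns A T) (target l) -ᵥ target l))
        ≤⟨ *-monoˡ-≤ 0≤lin (Σ-mono (allFin d) (λ l → ≤-trans (solves (length T) (columns A T) (target l))
             (*-monoʳ-≤ (cost-nonNegative T l) (reg-mono (ℕ.≤-trans ∣T∣≤ (coverSize≤budget k d)))))) ⟩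
      lin * Σ (allFin d) (λ l → ρ * cost T l)
        ≈⟨ *-congˡ (Σ-*ˡ (allFin d) ρ _) ⟩
      lin * (ρ * Σ (allFin d) (cost T))
        -- The covering bound is used with ν = 0, so its payment term is a zero inserted here.
        ≈⟨ ring-solve 6 (λ l r c a s n → l :* (r :* c) := r :* (l :* c :+ a :* (s :* (n :* con 0ℤ)))) refl lin ρ _ ati σ (fromℕ (length (allFin d))) ⟩
      ρ * (lin * Σ (allFin d) (cost T) + ati * (σ * (fromℕ (length (allFin d)) * 0#)))
        ≤⟨ *-monoˡ-≤ 0≤ρ (covers 0# (λ _ → mass-nonNegative _)) ⟩
      ρ * (ati * ((1# + (σ + σ)) * Σ (allFin d) mass))
        ≤⟨ *-monoˡ-≤ 0≤ρ (*-monoˡ-≤ 0≤ati (*-monoʳ-≤ (Σ-nonNegative (allFin d) mass-nonNegative) 1+2σ≤6σ)) ⟩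
      ρ * (ati * (fromℕ 6 * σ * Σ (allFin d) mass))
        ≈⟨ *-congˡ (*-congˡ (*-congˡ (norm≈Σ (A -ₘ Â)))) ⟨
      ρ * (ati * (fromℕ 6 * σ * norm g (A -ₘ Â)))
        ≈⟨ ring-solve 4 (λ r a s m → r :* (a :* (s :* m)) := :1 :* (s :* (r :* a) :* m)) refl _ _ _ _ ⟩
      1# * (fromℕ 6 * σ * (ρ * ati) * norm g (A -ₘ Â))
        ≈⟨ *-congʳ (⁻¹-inverseʳ (>⇒≉ 0<lin)) ⟨
      lin * lin ⁻¹ * (fromℕ 6 * σ * (ρ * ati) * norm g (A -ₘ Â))
        ≈⟨ ring-solve 5 (λ l b s x m → l :* b :* (s :* x :* m) := l :* (s :* (x :* b) :* m)) refl _ _ _ _ _ ⟩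
      lin * (C * norm g (A -ₘ Â)) ∎)
      where
      open Cover ati lin 0≤ati 0<lin growth 1≤k 3k≤t triangle Â rank hiding (σ)
      0≤lin = proj₁ 0<lin
      cover = coverAll ⌈log₂ d ⌉ (allFin d)
        (≡.subst (ℕ._≤ 2 ℕ.^ ⌈log₂ d ⌉) (≡.sym (List.length-tabulate id)) (n≤2^⌈log₂n⌉ d))
      T = proj₁ cover
      ∣T∣≤ = proj₁ (proj₂ cover)
      covers = proj₂ (proj₂ cover)
      1+2σ≤6σ : 1# + (σ + σ) ≤ fromℕ 6 * σ
      1+2σ≤6σ = begin
        1# + (σ + σ)     ≤⟨ +-monoˡ-≤ _ 1≤σ ⟩
        σ + (σ + σ)
          ≈⟨ ring-solve 1 (λ s → s :+ (s :+ s) := (:1 :+ (:1 :+ (:1 :+ con 0ℤ))) :* s) refl σ ⟩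
        fromℕ 3 * σ      ≤⟨ *-monoʳ-≤ 0≤σ (fromℕ-mono-≤ {3} {6} (ℕ.m≤m+n 3 3)) ⟩
        fromℕ 6 * σ      ∎

    norm-best-≤ : norm g (A -ₘ approximation N) ≤ C * minLowRank g k A
    norm-best-≤ = by-signs (0# ≤? ati) (0# ≤? ρ)
      where
      by-signs : Dec (0# ≤ ati) → Dec (0# ≤ ρ) → norm g (A -ₘ approximation N) ≤ C * minLowRank g k A
      by-signs (yes 0≤ati) (yes 0≤ρ) = ≤*minLowRank k (λ Â rank → ≤-respˡ-≈ (sym (norm-best N)) (error-≤ 0≤ati 0≤ρ Â rank))
      by-signs (no 0≰ati)  _         = degenerate⇒≤ (ati≤0⇒degenerate triangle (≰⇒≥ 0≰ati)) k (A -ₘ approximation N)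
      by-signs (yes _)     (no 0≰ρ)  = degenerate⇒≤ (reg≤0⇒degenerate solves (≰⇒≥ 0≰ρ)) k (A -ₘ approximation N)

theorem1p5 :
    Σ[ c ∈ ℕ ] Σ[ s ∈ (ℕ → ℕ) ] Σ[ m ∈ (ℕ → ℕ → ℕ) ]
    Σ[ select ∈ ColumnSelectionAlgorithm ]
      (∀ k → 1 ℕ.≤ k → s k ℕ.≤ c ℕ.* (k ℕ.* loglog k))
      × (∀ k d → 1 ℕ.≤ k → m k d ℕ.≤ c ℕ.* (s k ℕ.* log d))
      × (∀ (F : OrderedField) (complete : Complete F) →
         let open OrderedField F
             open Matrices F
             open Reals F complete
         in
         ∀ {n d} (A : Matrix n d) (k : ℕ) → 1 ℕ.≤ k →
         ∀ (g : Loss) (ati lin : Carrier) (reg : ℕ → Carrier)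
           (solve : RegressionSolver n) →
         ApproxTriangle g (2 ℕ.* s k ℕ.+ 1) ati →
         0# < lin →
         LinearGrowth g lin →
         (∀ {p q} → p ℕ.≤ q → reg p ≤ reg q) →
         SolvesRegression g reg solve →
         let SX = select F (Loss.fun g) solve A k
             S  = proj₁ SX
             X  = proj₂ SX
         in
         Subset.∣ S ∣ ℕ.≤ c ℕ.* (k ℕ.* loglog k ℕ.* log d ℕ.^ 2)
         × norm g (A -ₘ mulOver S (A ∣^ S) X)
           ≤ fromℕ c * √ℕ (s k) * (reg (m k d) * ati / lin) * minLowRank g k A)
theorem1p5 =
  -- The column count determines the constant 6; the size of s, the regression size and the loss
  -- need only 3, 2 and 3.
  6 , (λ k → 3 ℕ.* k) , budget , selectColumns ,
  (λ k _ → 3k≤6[k*loglog] k) ,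
  (λ k d _ → ℕ.*-monoˡ-≤ (3 ℕ.* k ℕ.* log d) (ℕ.m≤m+n 2 4)) ,
  λ F complete {n} {d} A k 1≤k g ati lin reg solve triangle 0<lin growth reg-mono solves →
    let open ExhaustiveSearch F (Matrices.Loss.fun g) solve A
        open Analysis F complete g ati lin reg solve A
    in ℕ.≤-trans (∣support∣≤length (best (budget k d))) (ℕ.≤-trans (length-best (budget k d)) (budget≤ k d)) ,
       -- The triangle inequality is given for 2s + 1 terms, while at most s + 1 terms occur.
       norm-best-≤ 1≤k (ℕ.m≤m+n (3 ℕ.* k) _)
         (≡.subst (λ t → Matrices.ApproxTriangle F g t ati) (ℕ.+-comm (2 ℕ.* (3 ℕ.* k)) 1) triangle)
         0<lin growth reg-mono solves
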